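{- Let $p$ be a prime power, and suppose there is a symmetric design $SBIBD\left(2p+1,p,\frac{p-1}{2}\right)$, with residual design $R$, a $BIBD\left(p+1,2p,p,\frac{p+1}{2},\frac{p-1}{2}\right)$, and derived design $D$, a $BIBD\left(p,2p,p-1,\frac{p-1}{2},\frac{p-3}{2}\right)$. Then for every positive integer $m$ there exists (constructed using $R$ and $D$ as seed designs) a symmetric design $$SBIBD\left(2p\,\frac{p^m-1}{p-1}+1,\; p^m,\; p^{m-1}\,\frac{p-1}{2}\right).$$
   Context: A $BIBD(v,b,r,k,\lambda)$ (balanced incomplete block design) consists of a set of $v$ points and a family of $b$ blocks (subsets of the point set; repeated blocks are allowed) such that every block has exactly $k$ points, every point lies in exactly $r$ blocks, and every two distinct points lie together in exactly $\lambda$ blocks. A symmetric design $SBIBD(v,k,\lambda)$ is a $BIBD(v,b,r,k,\lambda)$ with $b=v$ (hence $r=k$). Given a symmetric design $SBIBD(v,k,\lambda)$ and a block $B_0$, the residual design has as points the $v-k$ points not in $B_0$ and as blocks the sets $B\setminus B_0$ for the blocks $B\ne B_0$; the derived design has as points the $k$ points of $B_0$ and as blocks the sets $B\cap B_0$ for the blocks $B\neq B_0$. All parameters are integers, so the hypothesis forces $p$ to be odd. -}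

module Defs where

open import Data.Fin.Base using (Fin)
open import Data.Fin.Subset using (Subset; _∈_; _⊆_; _∩_; _─_; ∣_∣)
open import Data.Fin.Subset.Properties using (_∈?_)
open import Data.List.Base using (List; length; lookup; removeAt; map; filter)
open import Data.List.Relation.Unary.All using (All)
open import Data.Nat.Base
open import Data.Nat.Primality using (Prime; prime⇒nonZero; prime⇒nonTrivial)
open import Data.Nat.Properties using (m≤m*n; ≤-trans; m^n≢0; m<n⇒0<n∸m)
open import Data.Product.Base using (∃-syntax; _×_; _,_)
open import Relation.Binary.PropositionalEquality.Core using (_≡_; _≢_; refl)
open import Relation.Nullary.Decidable using (_×-dec_)

PrimePower : ℕ → Set
PrimePower q = ∃[ π ] ∃[ e ] Prime π × NonZero e × q ≡ π ^ e

primePower⇒pred-nonZero : ∀ {q} → PrimePower q → NonZero (q ∸ 1)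
primePower⇒pred-nonZero (π , suc e , π-prime , _ , refl) =
  >-nonZero (m<n⇒0<n∸m (≤-trans 1<π (m≤m*n π (π ^ e) {{m^n≢0 π e}})))
  where
  instance
    _ = prime⇒nonZero π-prime
  1<π : 1 < π
  1<π = nonTrivial⇒n>1 π {{prime⇒nonTrivial π-prime}}

-- The point set is an arbitrary subset of an ambient Fin n, so that residual and
-- derived designs need no relabelling of their points.  The blocks form a list
-- because repeated blocks are allowed; a block is identified by its position.
record Design : Set where
  field
    {ambient} : ℕ
    points    : Subset ambient
    blocks    : List (Subset ambient)

  Block : Set
  Block = Fin (length blocks)

record IsBIBD (D : Design) (v b r k lam : ℕ) : Set where
  open Design D
  field
    blocks⊆points : All (_⊆ points) blocks
    point-count   : ∣ points ∣ ≡ v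
    block-count   : length blocks ≡ b
    block-size    : All (λ B → ∣ B ∣ ≡ k) blocks
    replication   : ∀ {x} → x ∈ points →
                    length (filter (x ∈?_) blocks) ≡ r
    balance       : ∀ {x y} → x ∈ points → y ∈ points → x ≢ y →
                    length (filter (λ B → (x ∈? B) ×-dec (y ∈? B)) blocks) ≡ lam

IsSBIBD : Design → (v k lam : ℕ) → Set
IsSBIBD D v k lam = ∃[ r ] IsBIBD D v v r k lam

-- Only the occurrence B₀ is removed: other blocks equal to it as sets remain.
residual : (D : Design) → Design.Block D → Design
residual D B₀ = record
  { points = points ─ lookup blocks B₀
  ; blocks = map (_─ lookup blocks B₀) (removeAt blocks B₀)
  }
  where open Design D

derived : (D : Design) → Design.Block D → Design
derived D B₀ = record
  { points = lookup blocks B₀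
  ; blocks = map (_∩ lookup blocks B₀) (removeAt blocks B₀)
  }
  where open Design D

{-# OPTIONS --safe #-}
module Submission where

-- Write p = 2h + 1.  Let i range over the points of PG(m - 1, p), represented by normalised
-- vectors, and let χ be the quadratic character of the field F with p elements.  Replacing
-- each entry χ(i · j) of the balanced weighing matrix (χ(i · j)) by 0, by the incidence
-- matrix of R or by that of its complement (which has the same parameters as R) gives the
-- residual of the new design.  Its derived design has point set Fᵐ: for each direction j
-- the p hyperplanes y · j = s are identified with the p points s of D, and the blocks of D
-- become unions of parallel hyperplanes.  All pair counts follow because nonzero vectors,
-- and pairs of distinct normalised vectors, have equidistributed inner products.
--
-- The field is found without irreducible polynomials.  Starting from ℤ/π, adjoin formal
-- roots of X^q - X one after the other, obtaining a nontrivial ring with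
-- X^q - X = ∏ (X - aₖ), where the differences aᵢ - aⱼ are units since the derivative is -1.
-- For a root x the product ∏ (x - aₖ) vanishes, so a proper ideal can be enlarged, staying
-- proper, by some x - aₖ; doing this for all sums and products of the aₖ leaves a quotient in
-- which {aₖ} is a field.  The choice of k is classical, which is harmless because the
-- existence of operation tables on q elements is decidable.

open import Defs
open import Algebra.Bundles using (CommutativeRing)
open import Algebra.Core using (Op₁; Op₂)
open import Algebra.Morphism.Construct.Composition using (isRingHomomorphism)
open import Algebra.Morphism.Structures using (IsRingHomomorphism)
import Algebra.Properties.CommutativeSemiring.Binomial as Binomial
import Algebra.Properties.CommutativeSemiring.Exp as Exp
import Algebra.Properties.Ring as RingProperties
import Algebra.Properties.Semiring.Mult as Mult
import Algebra.Properties.Semiring.Sum as Sum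
import Algebra.Solver.Ring.NaturalCoefficients.Default as SemiringSolver
open import Algebra.Structures using (IsCommutativeRing)
open import Data.Bool.Base using (Bool; true; false; not; _xor_; _∧_; if_then_else_)
open import Data.Bool.Properties using (∧-zeroʳ; ∧-identityʳ; ∧-idem; ∧-comm)
open import Data.Empty using (⊥; ⊥-elim)
open import Data.Fin.Base using (Fin; zero; suc; fromℕ; inject₁; _<_; punchIn; punchOut; splitAt; join; remQuot; combine)
open import Data.Fin.Permutation using (Permutation; permutation)
open import Data.Fin.Properties using (_≟_; any?; all?; ¬∀⟶∃¬; toℕ-fromℕ; toℕ-inject₁; toℕ<n; injective⇒≤; suc-injective; punchOut-injective; punchInᵢ≢i; join-splitAt; combine-remQuot; _<?_; <-asym; <-irrefl; <-cmp)
open import Data.Fin.Subset using (Subset; _∈_; _⊆_; _∩_; _─_; ∣_∣)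
open import Data.Fin.Subset.Properties using (_∈?_)
import Data.Integer.Base as ℤ
import Data.Integer.Properties as ℤₚ
open import Data.List.Base as List using (List; []; _∷_; _++_; concat; length; filter; removeAt)
open import Data.List.Membership.Propositional.Properties using (∈-lookup)
open import Data.List.Properties using (length-tabulate; length-map)
open import Data.List.Relation.Unary.All as All using (All; []; _∷_)
open import Data.List.Relation.Unary.All.Properties using (++⁺; ++⁻; concat⁺; concat⁻; tabulate⁺; tabulate⁻)
open import Data.Maybe.Base as Maybe using (Maybe; just; nothing)
open import Data.Nat.Base as ℕ using (ℕ; zero; suc; NonZero)
open import Data.Nat.Combinatorics using (_C_; nCn≡1; nC1≡n; nCk+nC[k+1]≡[n+1]C[k+1]; k>n⇒nCk≡0)
open import Data.Nat.Divisibility using (_∣_; divides; m∣m*n; ∣⇒≤; ∣1⇒≡1)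
open import Data.Nat.DivMod using (m*n/n≡m; /-congˡ)
open import Data.Nat.Primality using (Prime; prime⇒nonZero; euclidsLemma; ¬prime[1])
import Data.Nat.Properties as ℕₚ
open import Data.Nat.Solver using (module +-*-Solver)
open import Data.Product.Base using (Σ; ∃-syntax; _×_; _,_; proj₁; proj₂; map₁)
import Data.Product.Properties as Productₚ
open import Data.Sum.Base as Sum⊎ using (_⊎_; inj₁; inj₂; [_,_]′)
import Data.Sum.Properties as Sum⊎ₚ
open import Data.Unit.Base using (⊤; tt)
open import Data.Vec.Base using (Vec; []; _∷_; map; lookup; replicate; tabulate)
open import Data.Vec.Properties using (map-∘; lookup∘tabulate; lookup-zipWith; []=⇒lookup; lookup⇒[]=)
open import Function.Base using (_∘_; id)
open import Function.Definitions using (Injective)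
open import Level using (0ℓ)
open import Relation.Binary.Core using (Rel)
open import Relation.Binary.Definitions using (tri<; tri≈; tri>)
open import Relation.Binary.PropositionalEquality using (_≡_; _≢_; cong; cong₂; subst; subst₂; module ≡-Reasoning)
import Relation.Binary.PropositionalEquality as ≡
open import Relation.Binary.Structures using (IsEquivalence)
open import Relation.Nullary using (¬_; Dec; yes; no; does; map′; _×-dec_; _⊎-dec_; ¬?)
open import Relation.Nullary.Decidable using (decidable-stable; _→-dec_)

-- Complementation acts on R like a sign. For two points of R, count their common blocks, using R or
-- its complement for each point: the four counts form a 2 by 2 table in which all rows and columns
-- sum to p. So changing both signs changes nothing, and for a fixed first sign the two second signs
-- contribute p together. Two distinct rows of the matrix therefore only need equal and opposite
-- signs equally often, and a single row only needs the right number of nonzero entries.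
-- Representatives of points may be rescaled freely, since a nonsquare factor merely complements.
-- Within Fᵐ, passing from vectors to directions leaves over the term of the zero vector; the block
-- V supplies exactly this term, which is why one extra block makes the counts agree. The hypotheses
-- give only the number p, so a field must be built. Membership in an ideal of the splitting ring is
-- not known to be decidable, hence maximal ideals are out of reach and each enlargement happens
-- under a double negation. Counts are stated multiplied out, so that all arguments stay in ℕ
-- without division.

Ring : Set₁
Ring = CommutativeRing 0ℓ 0ℓ

∣_∣ᴿ : Ring → Set
∣ R ∣ᴿ = CommutativeRing.Carrier R

Nontrivial : Ring → Set
Nontrivial R = let open CommutativeRing R in ¬ 1# ≈ 0#

mkRing : {A : Set} {_≈_ : Rel A 0ℓ} {_+_ _*_ : A → A → A} { -_ : A → A} {0# 1# : A} →
  IsEquivalence _≈_ →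
  (∀ {a b c d} → a ≈ b → c ≈ d → (a + c) ≈ (b + d)) →
  (∀ {a b c d} → a ≈ b → c ≈ d → (a * c) ≈ (b * d)) →
  (∀ {a b} → a ≈ b → (- a) ≈ (- b)) →
  (∀ a b c → ((a + b) + c) ≈ (a + (b + c))) →
  (∀ a b → (a + b) ≈ (b + a)) →
  (∀ a → (0# + a) ≈ a) →
  (∀ a → (a + (- a)) ≈ 0#) →
  (∀ a b c → ((a * b) * c) ≈ (a * (b * c))) →
  (∀ a b → (a * b) ≈ (b * a)) →
  (∀ a → (1# * a) ≈ a) →
  (∀ a b c → (a * (b + c)) ≈ ((a * b) + (a * c))) →
  Ring
mkRing {A} {_≈_} {_+_} {_*_} { -_} {0#} {1#} eq +c *c -c +a +comm 0l inv *a *comm 1l dist = record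
  { Carrier = A ; _≈_ = _≈_ ; _+_ = _+_ ; _*_ = _*_ ; -_ = -_ ; 0# = 0# ; 1# = 1#
  ; isCommutativeRing = record
    { isRing = record
      { +-isAbelianGroup = record
        { isGroup = record
          { isMonoid = record
            { isSemigroup = record
              { isMagma = record { isEquivalence = eq ; ∙-cong = +c }
              ; assoc = +a }
            ; identity = 0l , λ a → trans (+comm a 0#) (0l a) }
          ; inverse = (λ a → trans (+comm (- a) a) (inv a)) , inv
          ; ⁻¹-cong = -c }
        ; comm = +comm }
      ; *-cong = *c
      ; *-assoc = *a
      ; *-identity = 1l , λ a → trans (*comm a 1#) (1l a)
      ; distrib = dist , λ a b c →
          trans (*comm (b + c) a) (trans (dist a b c) (+c (*comm a b) (*comm a c))) }
    ; *-comm = *comm } }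
  where open IsEquivalence eq

IsHom : (R R′ : Ring) → (∣ R ∣ᴿ → ∣ R′ ∣ᴿ) → Set
IsHom R R′ = IsRingHomomorphism (CommutativeRing.rawRing R) (CommutativeRing.rawRing R′)

mkHom : ∀ {R R′ : Ring} {φ : ∣ R ∣ᴿ → ∣ R′ ∣ᴿ} →
  let module R = CommutativeRing R ; open CommutativeRing R′ in
  (∀ {a b} → a R.≈ b → φ a ≈ φ b) →
  (∀ a b → φ (a R.+ b) ≈ φ a + φ b) →
  (∀ a b → φ (a R.* b) ≈ φ a * φ b) →
  (∀ a → φ (R.- a) ≈ - φ a) →
  φ R.0# ≈ 0# → φ R.1# ≈ 1# → IsHom R R′ φ
mkHom c p m n z o = record
  { isSemiringHomomorphism = record
    { isNearSemiringHomomorphism = record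
      { +-isMonoidHomomorphism = record
        { isMagmaHomomorphism = record
          { isRelHomomorphism = record { cong = c }
          ; homo = p }
        ; ε-homo = z }
      ; *-homo = m }
    ; 1#-homo = o }
  ; -‿homo = n }

-- Ideals and quotients

record Ideal (R : Ring) : Set₁ where
  open CommutativeRing R
  field
    Member : ∣ R ∣ᴿ → Set
    resp   : ∀ {a b} → a ≈ b → Member a → Member b
    0-mem  : Member 0#
    +-mem  : ∀ {a b} → Member a → Member b → Member (a + b)
    *-mem  : ∀ r {a} → Member a → Member (r * a)

Proper : ∀ {R} → Ideal R → Set
Proper {R} I = ¬ Ideal.Member I (CommutativeRing.1# R)

zeroIdeal : ∀ R → Ideal R
zeroIdeal R = record
  { Member = _≈ 0#
  ; resp = λ e m → trans (sym e) m
  ; 0-mem = refl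
  ; +-mem = λ m n → trans (+-cong m n) (+-identityˡ 0#)
  ; *-mem = λ r m → trans (*-congˡ m) (zeroʳ r) }
  where open CommutativeRing R

adjoin : ∀ {R} → Ideal R → ∣ R ∣ᴿ → Ideal R
adjoin {R} I y = record
  { Member = λ a → ∃[ i ] ∃[ c ] Member i × a ≈ i + c * y
  ; resp = λ { e (i , c , m , p) → i , c , m , trans (sym e) p }
  ; 0-mem = 0# , 0# , 0-mem , sym (trans (+-identityˡ _) (zeroˡ y))
  ; +-mem = λ { (i , c , m , p) (j , d , n , q) → i + j , c + d , +-mem m n ,
      trans (+-cong p q) (solve 5 (λ i c j d y → (i :+ c :* y) :+ (j :+ d :* y) := (i :+ j) :+ (c :+ d) :* y) refl i c j d y) }
  ; *-mem = λ { r (i , c , m , p) → r * i , r * c , *-mem r m ,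
      trans (*-congˡ p) (solve 4 (λ r i c y → r :* (i :+ c :* y) := r :* i :+ (r :* c) :* y) refl r i c y) } }
  where
  open CommutativeRing R
  open Ideal I
  open SemiringSolver commutativeSemiring

-- Congruence is phrased as a ≈ b + i rather than a - b ≈ i, which makes all
-- congruence proofs but symmetry identities of semirings.
module _ {R : Ring} (I : Ideal R) where
  open CommutativeRing R
  open Ideal I
  open SemiringSolver commutativeSemiring using (solve; _:=_; _:+_; _:*_)
  open RingProperties ring using (-1*x≈-x; -‿+-comm)

  private
    infix 4 _~_
    _~_ : Rel Carrier 0ℓ
    a ~ b = ∃[ i ] Member i × a ≈ b + i

    neg-mem : ∀ {a} → Member a → Member (- a)
    neg-mem m = resp (-1*x≈-x _) (*-mem (- 1#) m)

    ≈⇒~ : ∀ {a b} → a ≈ b → a ~ b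
    ≈⇒~ e = 0# , 0-mem , trans e (sym (+-identityʳ _))

    ~-sym : ∀ {a b} → a ~ b → b ~ a
    ~-sym {a} {b} (i , m , p) = - i , neg-mem m ,
      sym (trans (+-congʳ p) (trans (+-assoc b i (- i)) (trans (+-congˡ (-‿inverseʳ i)) (+-identityʳ b))))

    ~-trans : ∀ {a b c} → a ~ b → b ~ c → a ~ c
    ~-trans (i , m , p) (j , n , q) = j + i , +-mem n m , trans p (trans (+-congʳ q) (+-assoc _ _ _))

    ~-+ : ∀ {a b c d} → a ~ b → c ~ d → a + c ~ b + d
    ~-+ {a} {b} {c} {d} (i , m , p) (j , n , q) = i + j , +-mem m n , trans (+-cong p q)
      (solve 4 (λ b d i j → (b :+ i) :+ (d :+ j) := (b :+ d) :+ (i :+ j)) refl b d i j)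

    ~-* : ∀ {a b c d} → a ~ b → c ~ d → a * c ~ b * d
    ~-* {a} {b} {c} {d} (i , m , p) (j , n , q) =
      b * j + (d + j) * i , +-mem (*-mem b n) (*-mem (d + j) m) , trans (*-cong p q)
      (solve 4 (λ b d i j → (b :+ i) :* (d :+ j) := (b :* d) :+ (b :* j :+ (d :+ j) :* i)) refl b d i j)

    ~-neg : ∀ {a b} → a ~ b → - a ~ - b
    ~-neg {a} {b} (i , m , p) = - i , neg-mem m , trans (-‿cong p) (sym (-‿+-comm b i))

  quotient : Ring
  quotient = mkRing {Carrier} {_~_} {_+_} {_*_} { -_} {0#} {1#}
    (record { refl = ≈⇒~ refl ; sym = ~-sym ; trans = ~-trans })
    ~-+ ~-* ~-neg
    (λ a b c → ≈⇒~ (+-assoc a b c)) (λ a b → ≈⇒~ (+-comm a b)) (λ a → ≈⇒~ (+-identityˡ a))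
    (λ a → ≈⇒~ (-‿inverseʳ a)) (λ a b c → ≈⇒~ (*-assoc a b c)) (λ a b → ≈⇒~ (*-comm a b))
    (λ a → ≈⇒~ (*-identityˡ a)) (λ a b c → ≈⇒~ (distribˡ a b c))

  quotient-nontrivial : Proper I → Nontrivial quotient
  quotient-nontrivial proper (i , m , p) = proper (resp (sym (trans p (+-identityˡ i))) m)

  quotient-hom : IsHom R quotient id
  quotient-hom = mkHom {R} {quotient} ≈⇒~ (λ _ _ → ≈⇒~ refl) (λ _ _ → ≈⇒~ refl) (λ _ → ≈⇒~ refl) (≈⇒~ refl) (≈⇒~ refl)

-- Monic polynomials: c₀ ∷ … ∷ cₙ₋₁ ∷ [] stands for c₀ + … + cₙ₋₁Xⁿ⁻¹ + Xⁿ.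

module Monic (R : Ring) where
  open CommutativeRing R

  eval deriv : ∀ {n} → Vec Carrier n → Carrier → Carrier
  eval []      x = 1#
  eval (c ∷ p) x = c + x * eval p x
  deriv []      x = 0#
  deriv (c ∷ p) x = eval p x + x * deriv p x

  -- Horner's scheme for division by X - `a`: the coefficients of the quotient are the values at `a`
  -- of the successive tails of the polynomial.
  synthDiv : ∀ {n} → Vec Carrier (suc n) → Carrier → Vec Carrier n
  synthDiv (c ∷ [])    a = []
  synthDiv (c ∷ d ∷ p) a = eval (d ∷ p) a ∷ synthDiv (d ∷ p) a

  product deriv-product : ∀ {n} → Vec Carrier n → Carrier → Carrier
  product []       x = 1#
  product (a ∷ as) x = (x + - a) * product as x
  deriv-product []       x = 0#
  deriv-product (a ∷ as) x = product as x + (x + - a) * deriv-product as x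

  infix 4 _≋_
  data _≋_ : ∀ {n} → Vec Carrier n → Vec Carrier n → Set where
    []  : [] ≋ []
    _∷_ : ∀ {n c d} {p q : Vec Carrier n} → c ≈ d → p ≋ q → c ∷ p ≋ d ∷ q

  ≋-refl : ∀ {n} {p : Vec Carrier n} → p ≋ p
  ≋-refl {p = []}    = []
  ≋-refl {p = _ ∷ _} = refl ∷ ≋-refl

  eval-cong : ∀ {n} {p q : Vec Carrier n} {x y} → p ≋ q → x ≈ y → eval p x ≈ eval q y
  eval-cong []       e = refl
  eval-cong (d ∷ ds) e = +-cong d (*-cong e (eval-cong ds e))

  deriv-cong : ∀ {n} {p q : Vec Carrier n} {x y} → p ≋ q → x ≈ y → deriv p x ≈ deriv q y
  deriv-cong []       e = refl
  deriv-cong (d ∷ ds) e = +-cong (eval-cong ds e) (*-cong e (deriv-cong ds e))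

  open SemiringSolver commutativeSemiring
    using (solve; _:=_; _:+_; _:*_; con)

  -- Division with remainder, evaluated at `a + y` rather than at x with a factor x - a: without
  -- subtraction each case is a semiring identity.
  eval-synthDiv : ∀ {n} (p : Vec Carrier (suc n)) a y →
    eval p (a + y) ≈ eval p a + y * eval (synthDiv p a) (a + y)
  eval-synthDiv (c ∷ []) a y =
    solve 3 (λ c a y → c :+ (a :+ y) :* con 1 := (c :+ a :* con 1) :+ y :* con 1) refl c a y
  eval-synthDiv (c ∷ d ∷ p) a y = trans (+-congˡ (*-congˡ (eval-synthDiv (d ∷ p) a y)))
    (solve 5 (λ c a y P D → c :+ (a :+ y) :* (P :+ y :* D) := (c :+ a :* P) :+ y :* (P :+ (a :+ y) :* D))
      refl c a y (eval (d ∷ p) a) (eval (synthDiv (d ∷ p) a) (a + y)))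

  deriv-synthDiv : ∀ {n} (p : Vec Carrier (suc n)) a y →
    deriv p (a + y) ≈ eval (synthDiv p a) (a + y) + y * deriv (synthDiv p a) (a + y)
  deriv-synthDiv (c ∷ []) a y =
    solve 2 (λ a y → con 1 :+ (a :+ y) :* con 0 := con 1 :+ y :* con 0) refl a y
  deriv-synthDiv (c ∷ d ∷ p) a y =
    trans (+-cong (eval-synthDiv (d ∷ p) a y) (*-congˡ (deriv-synthDiv (d ∷ p) a y)))
    (solve 5 (λ a y P D D′ → (P :+ y :* D) :+ (a :+ y) :* (D :+ y :* D′)
                := (P :+ (a :+ y) :* D) :+ y :* (D :+ (a :+ y) :* D′))
      refl a y (eval (d ∷ p) a) (eval (synthDiv (d ∷ p) a) (a + y)) (deriv (synthDiv (d ∷ p) a) (a + y)))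

module _ {R R′ : Ring} {φ : ∣ R ∣ᴿ → ∣ R′ ∣ᴿ} (φ-hom : IsHom R R′ φ) where
  private
    module R = CommutativeRing R
    module M = Monic R
    open CommutativeRing R′
    open Monic R′
    open IsRingHomomorphism φ-hom

  eval-hom : ∀ {n} (p : Vec R.Carrier n) x → φ (M.eval p x) ≈ eval (map φ p) (φ x)
  eval-hom []      x = 1#-homo
  eval-hom (c ∷ p) x = trans (+-homo _ _) (+-congˡ (trans (*-homo _ _) (*-congˡ (eval-hom p x))))

  synthDiv-hom : ∀ {n} (p : Vec R.Carrier (suc n)) x →
    synthDiv (map φ p) (φ x) ≋ map φ (M.synthDiv p x)
  synthDiv-hom (c ∷ [])    x = []
  synthDiv-hom (c ∷ d ∷ p) x = sym (eval-hom (d ∷ p) x) ∷ synthDiv-hom (d ∷ p) x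

-- Adjoining a root of a monic polynomial f.  Polynomials act on sequences by
-- shifting; in R[X]/(f), two polynomials are equal iff they act equally on all
-- sequences satisfying the linear recurrence f.  No multiplication of coefficient
-- lists is needed, and the ring is nontrivial because f has a nonzero solution.

module AdjoinRoot (R : Ring) where
  open CommutativeRing R
  open SemiringSolver commutativeSemiring
    using (solve; _:=_; _:+_; _:*_; con)

  infixl 6 _⊕_
  infixl 7 _⊗_
  data Poly : Set where
    const   : Carrier → Poly
    X       : Poly
    _⊕_ _⊗_ : Poly → Poly → Poly

  Seq : Set
  Seq = ℕ → Carrier

  infix 4 _≐_
  _≐_ : Rel Seq 0ℓ
  s ≐ t = ∀ k → s k ≈ t k

  act : Poly → Seq → Seq
  act (const r) s k = r * s k
  act X         s k = s (suc k)
  act (p ⊕ q)   s k = act p s k + act q s k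
  act (p ⊗ q)   s   = act p (act q s)

  act-cong : ∀ p {s t} → s ≐ t → act p s ≐ act p t
  act-cong (const r) e k = *-congˡ (e k)
  act-cong X         e k = e (suc k)
  act-cong (p ⊕ q)   e k = +-cong (act-cong p e k) (act-cong q e k)
  act-cong (p ⊗ q)   e   = act-cong p (act-cong q e)

  act-+ : ∀ p s t → act p (λ k → s k + t k) ≐ λ k → act p s k + act p t k
  act-+ (const r) s t k = distribˡ r (s k) (t k)
  act-+ X         s t k = refl
  act-+ (p ⊕ q)   s t k = trans (+-cong (act-+ p s t k) (act-+ q s t k))
    (solve 4 (λ a b c d → (a :+ b) :+ (c :+ d) := (a :+ c) :+ (b :+ d)) refl _ _ _ _)
  act-+ (p ⊗ q)   s t k = trans (act-cong p (act-+ q s t) k) (act-+ p _ _ k)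

  act-comm : ∀ p q s → act p (act q s) ≐ act q (act p s)
  act-comm (const r) (const t) s k = solve 3 (λ r t a → r :* (t :* a) := t :* (r :* a)) refl r t (s k)
  act-comm (const r) X         s k = refl
  act-comm X         (const t) s k = refl
  act-comm X         X         s k = refl
  act-comm (p ⊕ p′)  (const t) s k =
    trans (+-cong (act-comm p (const t) s k) (act-comm p′ (const t) s k)) (sym (distribˡ t _ _))
  act-comm (p ⊕ p′)  X         s k = +-cong (act-comm p X s k) (act-comm p′ X s k)
  act-comm (p ⊗ p′)  q@(const _) s k = trans (act-cong p (act-comm p′ q s) k) (act-comm p q _ k)
  act-comm (p ⊗ p′)  q@X         s k = trans (act-cong p (act-comm p′ q s) k) (act-comm p q _ k)
  act-comm p (q ⊕ q′) s k =
    trans (act-+ p _ _ k) (+-cong (act-comm p q s k) (act-comm p q′ s k))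
  act-comm p (q ⊗ q′) s k =
    trans (act-comm p q _ k) (act-cong q (act-comm p q′ s) k)

  polynomial : ∀ {n} → Vec Carrier n → Poly
  polynomial []      = const 1#
  polynomial (c ∷ f) = const c ⊕ X ⊗ polynomial f

  act-0 : ∀ p → act p (λ _ → 0#) ≐ λ _ → 0#
  act-0 (const r) k = zeroʳ r
  act-0 X         k = refl
  act-0 (p ⊕ q)   k = trans (+-cong (act-0 p k) (act-0 q k)) (+-identityˡ 0#)
  act-0 (p ⊗ q)   k = trans (act-cong p (act-0 q) k) (act-0 p k)

  module _ {n} (f : Vec Carrier n) where

    Recurrent : Seq → Set
    Recurrent s = ∀ k → act (polynomial f) s k ≈ 0#

    infix 4 _~_
    _~_ : Rel Poly 0ℓ
    p ~ q = ∀ s → Recurrent s → act p s ≐ act q s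

    act-recurrent : ∀ p {s} → Recurrent s → Recurrent (act p s)
    act-recurrent p {s} rec k =
      trans (act-comm (polynomial f) p s k) (trans (act-cong p rec k) (act-0 p k))

    extension : Ring
    extension = mkRing {Poly} {_~_} {_⊕_} {_⊗_} {const (- 1#) ⊗_} {const 0#} {const 1#}
      (record { refl = λ _ _ _ → refl ; sym = λ e s r k → sym (e s r k)
              ; trans = λ e d s r k → trans (e s r k) (d s r k) })
      (λ e d s r k → +-cong (e s r k) (d s r k))
      -- The equality of the outer factors is tested on `act q′ s`, which again satisfies the
      -- recurrence.
      (λ {p} {q} {p′} {q′} e d s r k → trans (act-cong p (d s r) k) (e _ (act-recurrent q′ r) k))
      (λ e s r k → *-congˡ (e s r k))
      (λ a b c s r k → +-assoc _ _ _)
      (λ a b s r k → +-comm _ _)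
      (λ a s r k → trans (+-congʳ (zeroˡ _)) (+-identityˡ _))
      (λ a s r k → trans (trans (+-congʳ (sym (*-identityˡ _)))
        (trans (sym (distribʳ _ 1# (- 1#))) (*-congʳ (-‿inverseʳ 1#)))) (trans (zeroˡ _) (sym (zeroˡ _))))
      (λ a b c s r k → refl)
      (λ a b s r → act-comm a b s)
      (λ a s r k → *-identityˡ _)
      (λ a b c s r → act-+ a _ _)

    const-hom : IsHom R extension const
    const-hom = mkHom {R} {extension} (λ e s r k → *-congʳ e) (λ a b s r k → distribʳ _ a b)
      (λ a b s r k → *-assoc a b _)
      (λ a s r k → trans (*-congʳ (sym (-1*x≈-x a))) (*-assoc _ a _))
      (λ s r k → refl) (λ s r k → refl)
      where open RingProperties ring using (-1*x≈-x)

    private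
      eval-polynomial : ∀ {m} (g : Vec Carrier m) →
        Monic.eval extension (map const g) X ≡ polynomial g
      eval-polynomial []      = ≡.refl
      eval-polynomial (c ∷ g) = cong (λ h → const c ⊕ X ⊗ h) (eval-polynomial g)

    X-root : CommutativeRing._≈_ extension (Monic.eval extension (map const f) X) (const 0#)
    X-root s rec k rewrite eval-polynomial f = trans (rec k) (sym (zeroˡ _))

  dot : ∀ {n} → Vec Carrier n → Seq → Carrier
  dot []      t = 0#
  dot (c ∷ f) t = c * t 0 + dot f (t ∘ suc)

  dot-cong : ∀ {n} (f : Vec Carrier n) {s t : Seq} → (∀ i → i ℕ.< n → s i ≈ t i) → dot f s ≈ dot f t
  dot-cong []      e = refl
  dot-cong (c ∷ f) e = +-cong (*-congˡ (e 0 (ℕ.s≤s ℕ.z≤n))) (dot-cong f (λ i i<n → e (suc i) (ℕ.s≤s i<n)))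

  act-polynomial : ∀ {n} (f : Vec Carrier n) s k →
    act (polynomial f) s k ≈ dot f (λ i → s (i ℕ.+ k)) + s (n ℕ.+ k)
  act-polynomial []      s k = trans (*-identityˡ _) (sym (+-identityˡ _))
  act-polynomial {suc n} (c ∷ f) s k =
    trans (+-congˡ (trans (act-polynomial f s (suc k))
      (+-cong (dot-cong f (λ i _ → reflexive (cong s (ℕₚ.+-suc i k)))) (reflexive (cong s (ℕₚ.+-suc n k))))))
      (sym (+-assoc _ _ _))

  module _ {n} (f : Vec Carrier (suc n)) where
    private
      next : Seq → ∀ i → Dec (i ≡ n) → Carrier
      next w i (yes _) = - dot f w
      next w i (no _)  = w (suc i)

      -- The first suc n entries of window k are those of the solution from k on.
      window : ℕ → Seq
      window zero    zero    = 1#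
      window zero    (suc i) = 0#
      window (suc k) i       = next (window k) i (i ℕₚ.≟ n)

      solution : Seq
      solution k = window k 0

      next-shift : ∀ w i d → i ℕ.< n → next w i d ≈ w (suc i)
      next-shift w i (yes ≡.refl) i<n = ⊥-elim (ℕₚ.<-irrefl ≡.refl i<n)
      next-shift w i (no _)       i<n = refl

      next-last : ∀ w d → next w n d ≈ - dot f w
      next-last w (yes _) = refl
      next-last w (no ¬p) = ⊥-elim (¬p ≡.refl)

      window-solution : ∀ i k → i ℕ.≤ n → window k i ≈ solution (i ℕ.+ k)
      window-solution zero    k _   = refl
      window-solution (suc i) k i<n = trans (sym (next-shift (window k) i (i ℕₚ.≟ n) i<n))
        (trans (window-solution i (suc k) (ℕₚ.<⇒≤ i<n)) (reflexive (cong solution (ℕₚ.+-suc i k))))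

    solution-recurrent : Recurrent f solution
    solution-recurrent k = trans (act-polynomial f solution k) (trans (+-cong
      (dot-cong f (λ i i<n → sym (window-solution i k (ℕ.s≤s⁻¹ i<n))))
      (trans (reflexive (cong solution (≡.sym (ℕₚ.+-suc n k))))
        (trans (sym (window-solution n (suc k) ℕₚ.≤-refl)) (next-last (window k) (n ℕₚ.≟ n)))))
      (-‿inverseʳ _))

    -- The solution starts with the value 1, so its entry at 0 already tells the actions of 1 and 0
    -- apart.
    extension-nontrivial : Nontrivial R → Nontrivial (extension f)
    extension-nontrivial nt 1~0 = nt (trans (sym (*-identityˡ 1#))
      (trans (1~0 solution solution-recurrent 0) (zeroˡ 1#)))

-- Splitting rings of monic polynomials

record Splitting (R : Ring) {n} (f : Vec ∣ R ∣ᴿ n) : Set₁ where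
  field
    top        : Ring
    nontrivial : Nontrivial top
    embed      : ∣ R ∣ᴿ → ∣ top ∣ᴿ
    embed-hom  : IsHom R top embed
    roots      : Vec ∣ top ∣ᴿ n
  open CommutativeRing top
  open Monic top
  field
    eval-split  : ∀ x → eval (map embed f) x ≈ product roots x
    -- Over a general ring a polynomial function does not determine its coefficients, so this does
    -- not follow from `eval-split` and is carried along. It is what makes differences of roots
    -- units.
    deriv-split : ∀ x → deriv (map embed f) x ≈ deriv-product roots x

splitting : ∀ {n} (R : Ring) → Nontrivial R → (f : Vec ∣ R ∣ᴿ n) → Splitting R f
splitting R nt [] = record
  { top = R ; nontrivial = nt ; embed = id
  ; embed-hom = mkHom {R} {R} id (λ _ _ → refl) (λ _ _ → refl) (λ _ → refl) refl refl
  ; roots = [] ; eval-split = λ _ → refl ; deriv-split = λ _ → refl }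
  where open CommutativeRing R
splitting {suc n} R nt f = record
  { top = top ; nontrivial = nontrivial ; embed = embed ∘ const
  ; embed-hom = isRingHomomorphism trans const-hom′ embed-hom
  ; roots = b ∷ roots
  ; eval-split = λ x → trans (eval-cong (≋-refl {p = F}) (shift x)) (trans (eval-synthDiv F b (x + - b))
      (trans (+-cong F-root (*-congˡ (trans (eval-cong quot≋ (sym (shift x))) (eval-split x)))) (+-identityˡ _)))
  ; deriv-split = λ x → trans (deriv-cong (≋-refl {p = F}) (shift x)) (trans (deriv-synthDiv F b (x + - b))
      (+-cong (trans (eval-cong quot≋ (sym (shift x))) (eval-split x))
        (*-congˡ (trans (deriv-cong quot≋ (sym (shift x))) (deriv-split x))))) }
  where
  open AdjoinRoot R
  R₁ = extension f
  const-hom′ = const-hom f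
  -- The adjoined `X` is a root of f, so f splits off a linear factor; the recursive call splits the
  -- quotient, over a still larger ring.
  g = Monic.synthDiv R₁ (map const f) X
  open Splitting (splitting R₁ (extension-nontrivial f nt) g)
  open CommutativeRing top
  open Monic top
  open IsRingHomomorphism embed-hom using (⟦⟧-cong; 0#-homo)
  b = embed X
  F = map (embed ∘ const) f
  F≡ : F ≡ map embed (map const f)
  F≡ = map-∘ embed const f
  shift : ∀ x → x ≈ b + (x + - b)
  shift x = sym (trans (+-comm b _) (trans (+-assoc x _ b) (trans (+-congˡ (-‿inverseˡ b)) (+-identityʳ x))))
  F-root : eval F b ≈ 0#
  F-root = trans (reflexive (cong (λ p → eval p b) F≡))
    (trans (sym (eval-hom embed-hom (map const f) X)) (trans (⟦⟧-cong (X-root f)) 0#-homo))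
  quot≋ : synthDiv F b ≋ map embed g
  quot≋ = subst (λ p → synthDiv p b ≋ map embed g) (≡.sym F≡) (synthDiv-hom embed-hom (map const f) X)

-- The Frobenius map

-- This displays the factor `suc n` without dividing, ready for Euclid's lemma when `suc n` is
-- prime.
absorption : ∀ n k → suc k ℕ.* (suc n C suc k) ≡ suc n ℕ.* (n C k)
absorption zero    zero    = ≡.refl
absorption zero    (suc k) = ≡.trans (cong (suc (suc k) ℕ.*_) (k>n⇒nCk≡0 {1} {2 ℕ.+ k} (ℕ.s≤s (ℕ.s≤s ℕ.z≤n))))
  (ℕₚ.*-zeroʳ (suc (suc k)))
absorption (suc n) zero    = ≡.trans (ℕₚ.*-identityˡ _) (≡.trans (nC1≡n (suc (suc n))) (≡.sym (ℕₚ.*-identityʳ _)))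
absorption (suc n) (suc k) = begin
  suc (suc k) ℕ.* (suc (suc n) C suc (suc k))
    ≡⟨ cong (suc (suc k) ℕ.*_) (nCk+nC[k+1]≡[n+1]C[k+1] (suc n) (suc k)) ⟨
  suc (suc k) ℕ.* ((suc n C suc k) ℕ.+ (suc n C suc (suc k)))
    ≡⟨ solve 3 (λ k a b → (con 2 :+ k) :* (a :+ b) := a :+ (con 1 :+ k) :* a :+ (con 2 :+ k) :* b) ≡.refl k (suc n C suc k) (suc n C suc (suc k)) ⟩
  (suc n C suc k) ℕ.+ suc k ℕ.* (suc n C suc k) ℕ.+ suc (suc k) ℕ.* (suc n C suc (suc k))
    ≡⟨ cong₂ (λ a b → (suc n C suc k) ℕ.+ a ℕ.+ b) (absorption n k) (absorption n (suc k)) ⟩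
  (suc n C suc k) ℕ.+ suc n ℕ.* (n C k) ℕ.+ suc n ℕ.* (n C suc k)
    ≡⟨ solve 4 (λ n a b c → c :+ (con 1 :+ n) :* a :+ (con 1 :+ n) :* b := c :+ (con 1 :+ n) :* (a :+ b)) ≡.refl n (n C k) (n C suc k) (suc n C suc k) ⟩
  (suc n C suc k) ℕ.+ suc n ℕ.* ((n C k) ℕ.+ (n C suc k))
    ≡⟨ cong (λ a → (suc n C suc k) ℕ.+ suc n ℕ.* a) (nCk+nC[k+1]≡[n+1]C[k+1] n k) ⟩
  suc (suc n) ℕ.* (suc n C suc k) ∎
  where
  open ≡-Reasoning
  open +-*-Solver

-- The prime divides the left side of `absorption`, but not the factor `suc k`, which is smaller.
prime∣binomial : ∀ {n k} → Prime (suc n) → k ℕ.< n → suc n ∣ (suc n C suc k)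
prime∣binomial {n} {k} 1+n-prime k<n
  with euclidsLemma (suc k) (suc n C suc k) 1+n-prime (subst (suc n ∣_) (≡.sym (absorption n k)) (m∣m*n (n C k)))
... | inj₁ d = ⊥-elim (ℕₚ.≤⇒≯ (∣⇒≤ d) (ℕ.s≤s k<n))
... | inj₂ d = d

module Frobenius (R : Ring) {π : ℕ} (π-prime : Prime π)
  (char : CommutativeRing._≈_ R (Mult._×_ (CommutativeRing.semiring R) π (CommutativeRing.1# R)) (CommutativeRing.0# R)) where
  open CommutativeRing R hiding (zero)
  open Mult semiring using (×-assoc-*; ×-congʳ; ×-assocˡ; ×-homo-1) renaming (_×_ to _·_)
  open Sum semiring using (sum-cong-≋; sum-init-last; sum-replicate-zero)
  open Exp commutativeSemiring using (_^_; ^-assocʳ; ^-congˡ; ^-distrib-*)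
  open RingProperties ring using (+-inverseʳ-unique)

  char-× : ∀ {n} → π ∣ n → ∀ x → n · x ≈ 0#
  char-× (divides c ≡.refl) x = trans (sym (×-assocˡ x c π)) (trans (×-congʳ c char-x) (zeros c))
    where
    char-x : π · x ≈ 0#
    char-x = trans (×-congʳ π (sym (*-identityˡ x))) (trans (sym (×-assoc-* π 1# x)) (trans (*-congʳ char) (zeroˡ x)))
    zeros : ∀ c → c · 0# ≈ 0#
    zeros zero    = refl
    zeros (suc c) = trans (+-identityˡ _) (zeros c)

  private
    -- Only the two outer terms of the binomial expansion survive. Writing π as `suc n` lets the sum
    -- be peeled at both ends.
    prime-power-sum : ∀ n → π ≡ suc n → ∀ x y → (x + y) ^ suc n ≈ x ^ suc n + y ^ suc n
    prime-power-sum n eq x y = trans (theorem (suc n) x y) (trans (+-cong first (trans (sum-init-last (λ i → term (suc i)))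
      (+-cong (trans (sum-cong-≋ {n} middle) (sum-replicate-zero n)) last′))) (trans (+-congˡ (+-identityˡ _)) (+-comm _ _)))
      where
      open Binomial commutativeSemiring using (theorem; binomialTerm)
      term = binomialTerm x y (suc n)
      first : term zero ≈ y ^ suc n
      first = trans (×-homo-1 _) (*-identityˡ _)
      middle : ∀ i → term (suc (inject₁ i)) ≈ 0#
      middle i = char-× (subst₂ _∣_ (≡.sym eq) (cong (λ k → suc n C suc k) (≡.sym (toℕ-inject₁ i)))
        (prime∣binomial (subst Prime eq π-prime) (toℕ<n i))) _
      last′ : term (suc (fromℕ n)) ≈ x ^ suc n
      last′ rewrite toℕ-fromℕ n | nCn≡1 (suc n) | ℕₚ.n∸n≡0 n = trans (×-homo-1 _) (*-identityʳ _)

  ^-prime-+ : ∀ x y → (x + y) ^ π ≈ x ^ π + y ^ π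
  ^-prime-+ = subst (λ p → ∀ x y → (x + y) ^ p ≈ x ^ p + y ^ p) (≡.sym π≡) (prime-power-sum _ π≡)
    where
    π≡ : π ≡ suc (ℕ.pred π)
    π≡ = ≡.sym (ℕₚ.suc-pred π {{prime⇒nonZero π-prime}})

  ^-primePower-+ : ∀ e x y → (x + y) ^ (π ℕ.^ e) ≈ x ^ (π ℕ.^ e) + y ^ (π ℕ.^ e)
  ^-primePower-+ zero    x y = trans (*-identityʳ _) (+-cong (sym (*-identityʳ x)) (sym (*-identityʳ y)))
  ^-primePower-+ (suc e) x y = trans (sym (^-assocʳ _ π q)) (trans (^-congˡ q (^-prime-+ x y))
    (trans (^-primePower-+ e _ _) (+-cong (^-assocʳ x π q) (^-assocʳ y π q))))
    where q = π ℕ.^ e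

  module Fixed (e k : ℕ) (q≡ : 2 ℕ.+ k ≡ π ℕ.^ e) where
    private
      q = 2 ℕ.+ k
    ^q-+ : ∀ x y → (x + y) ^ q ≈ x ^ q + y ^ q
    ^q-+ = subst (λ q → ∀ x y → (x + y) ^ q ≈ x ^ q + y ^ q) (≡.sym q≡) (^-primePower-+ e)

    fixed-0 : 0# ^ q ≈ 0#
    fixed-0 = zeroˡ _

    fixed-1 : 1# ^ q ≈ 1#
    fixed-1 = go q where
      go : ∀ n → 1# ^ n ≈ 1#
      go zero    = refl
      go (suc n) = trans (*-identityˡ _) (go n)

    fixed-+ : ∀ {x y} → x ^ q ≈ x → y ^ q ≈ y → (x + y) ^ q ≈ x + y
    fixed-+ {x} {y} p r = trans (^q-+ x y) (+-cong p r)

    fixed-* : ∀ {x y} → x ^ q ≈ x → y ^ q ≈ y → (x * y) ^ q ≈ x * y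
    fixed-* {x} {y} p r = trans (^-distrib-* x y q) (*-cong p r)

    -- Additivity of the q-th power makes `(- x) ^ q` the additive inverse of `x ^ q`; no parity of
    -- q enters, so characteristic 2 is no exception.
    fixed-neg : ∀ {x} → x ^ q ≈ x → (- x) ^ q ≈ - x
    fixed-neg {x} p = +-inverseʳ-unique x ((- x) ^ q)
      (trans (+-congʳ (sym p)) (trans (sym (^q-+ x (- x))) (trans (^-congˡ q (-‿inverseʳ x)) fixed-0)))

-- The polynomial X^q - X

module Xq-X (R : Ring) where
  open CommutativeRing R hiding (zero)
  open Monic R
  open Mult semiring using (×-comm-*; ×-congʳ; ×-assoc-*) renaming (_×_ to _·_)
  open Exp commutativeSemiring using (_^_)

  xq-x : ∀ k → Vec Carrier (2 ℕ.+ k)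
  xq-x k = 0# ∷ - 1# ∷ replicate k 0#

  eval-zeros : ∀ k x → eval (replicate k 0#) x ≈ x ^ k
  eval-zeros zero    x = refl
  eval-zeros (suc k) x = trans (+-identityˡ _) (*-congˡ (eval-zeros k x))

  deriv-zeros : ∀ k x → x * deriv (replicate k 0#) x ≈ k · x ^ k
  deriv-zeros zero    x = zeroʳ x
  deriv-zeros (suc k) x = trans (*-congˡ (+-cong (eval-zeros k x) (deriv-zeros k x)))
    (trans (distribˡ x _ _) (+-congˡ (×-comm-* k x (x ^ k))))

  eval-xq-x : ∀ k x → eval (xq-x k) x ≈ x ^ (2 ℕ.+ k) + - x
  eval-xq-x k x = trans (+-identityˡ _) (trans (*-congˡ (+-congˡ (*-congˡ (eval-zeros k x))))
    (trans (distribˡ x _ _) (trans (+-comm _ _) (+-congˡ (trans (*-comm x _) (-1*x≈-x x))))))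
    where open RingProperties ring using (-1*x≈-x)

  deriv-xq-x : ∀ k x → (2 ℕ.+ k) · 1# ≈ 0# → deriv (xq-x k) x ≈ - 1#
  deriv-xq-x k x char = trans (+-cong (+-congˡ (*-congˡ (eval-zeros k x)))
      (*-congˡ (+-cong (eval-zeros k x) (deriv-zeros k x))))
    (trans (+-congˡ (trans (distribˡ x _ _) (+-congˡ (×-comm-* k x (x ^ k)))))
    (trans (+-assoc (- 1#) _ _) (trans (+-congˡ vanish) (+-identityʳ _))))
    where
    y = x * x ^ k
    vanish : y + (y + k · y) ≈ 0#
    vanish = trans (×-congʳ (2 ℕ.+ k) (sym (*-identityˡ y))) (trans (sym (×-assoc-* (2 ℕ.+ k) 1# y)) (trans (*-congʳ char) (zeroˡ y)))

-- Proper ideals modulo which given roots of ∏ (X - aₖ) become equal to some aₖ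

module Separate (R : Ring) where
  open CommutativeRing R hiding (zero)
  open Monic R
  open SemiringSolver commutativeSemiring using (solve; _:=_; _:+_; _:*_)
  open RingProperties ring using (-1*x≈-x; -‿+-comm; -‿involutive)

  Unit : Carrier → Set
  Unit u = ∃[ v ] v * u ≈ 1#

  unit-factorˡ : ∀ {u v w} → Unit w → w ≈ u * v → Unit u
  unit-factorˡ {u} {v} (t , tw≈1) w≈uv = t * v , trans (trans (*-assoc t v u) (*-congˡ (trans (*-comm v u) (sym w≈uv)))) tw≈1

  product-root : ∀ {n} (as : Vec Carrier n) i → product as (lookup as i) ≈ 0#
  product-root (a ∷ as) zero    = trans (*-congʳ (-‿inverseʳ a)) (zeroˡ _)
  product-root (a ∷ as) (suc i) = trans (*-congˡ (product-root as i)) (zeroʳ _)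

  infix 4 _~[_]_
  _~[_]_ : Carrier → Ideal R → Carrier → Set
  a ~[ I ] b = CommutativeRing._≈_ (quotient I) a b

  proper⇒¬unit : ∀ (I : Ideal R) → Proper I → ∀ {a b} → Unit (a + - b) → ¬ a ~[ I ] b
  proper⇒¬unit I proper {a} {b} (v , vu≈1) (i , m , p) = proper (resp (trans (*-congˡ (sym a-b≈i)) vu≈1) (*-mem v m))
    where
    open Ideal I
    a-b≈i : a + - b ≈ i
    a-b≈i = trans (+-congʳ (trans p (+-comm b i))) (trans (+-assoc i b (- b)) (trans (+-congˡ (-‿inverseʳ b)) (+-identityʳ i)))

  -- The derivative of ∏ (X - aₖ) at aᵢ is the product of all aᵢ - aⱼ with j ≠ i, and every factor
  -- of a unit is a unit.
  units-apart : ∀ {n} (as : Vec Carrier n) → (∀ i → Unit (deriv-product as (lookup as i))) →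
    ∀ i j → i ≢ j → Unit (lookup as i + - lookup as j)
  units-apart (a ∷ as) unit = go
    where
    split : ∀ i → let b = lookup as i in deriv-product (a ∷ as) b ≈ (b + - a) * deriv-product as b
    split i = trans (+-congʳ (product-root as i)) (+-identityˡ _)
    negate : ∀ b → b + - a ≈ (a + - b) * - 1#
    negate b = sym (trans (*-comm _ _) (trans (-1*x≈-x _) (trans (sym (-‿+-comm a (- b)))
      (trans (+-comm _ _) (+-congʳ (-‿involutive b))))))
    go : ∀ i j → i ≢ j → Unit (lookup (a ∷ as) i + - lookup (a ∷ as) j)
    go zero    zero    i≢j = ⊥-elim (i≢j ≡.refl)
    go zero    (suc j) _   = unit-factorˡ (go (suc j) zero λ ()) (negate (lookup as j))
    go (suc i) zero    _   = unit-factorˡ (unit (suc i)) (split i)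
    go (suc i) (suc j) i≢j = units-apart as
      (λ k → unit-factorˡ (unit (suc k)) (trans (split k) (*-comm _ _))) i j (i≢j ∘ cong suc)

  -- If 1 = i + c u with i in `I`, then v = v i + c (u v) lies in `I`. The conclusion is doubly
  -- negated because failing to be proper is itself a double negation.
  cancel : ∀ (I : Ideal R) {u v} → ¬ Proper (adjoin I u) → Ideal.Member I (u * v) → ¬ ¬ Ideal.Member I v
  cancel I {u} {v} ¬proper uv∈I v∉I = ¬proper λ { (i , c , m , p) → v∉I
    (resp (trans (trans (solve 4 (λ v i c u → v :* i :+ c :* (u :* v) := (i :+ c :* u) :* v) refl v i c u)
      (*-congʳ (sym p))) (*-identityˡ v)) (+-mem (*-mem v m) (*-mem c uv∈I))) }
    where open Ideal I

  -- If no choice of k stayed proper, `cancel` would strip the factors x - aₖ from the product one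
  -- by one and leave 1 in `I`.
  choose-root : ∀ (I : Ideal R) → Proper I → ∀ {n} (as : Vec Carrier n) x → Ideal.Member I (product as x) →
    ¬ ¬ (∃[ k ] Proper (adjoin I (x + - lookup as k)))
  choose-root I proper []       x m none = proper m
  choose-root I proper (a ∷ as) x m none = cancel I (λ p → none (zero , p)) m
    λ m′ → choose-root I proper as x m′ λ { (k , p) → none (suc k , p) }

  infix 4 _⊑_
  _⊑_ : Ideal R → Ideal R → Set
  I ⊑ J = ∀ {a} → Ideal.Member I a → Ideal.Member J a

  ~-mono : ∀ {I J a b} → I ⊑ J → a ~[ I ] b → a ~[ J ] b
  ~-mono I⊑J (i , m , p) = i , I⊑J m , p

  ⊑-adjoin : ∀ I y → I ⊑ adjoin I y
  ⊑-adjoin I y {a} m = a , 0# , m , sym (trans (+-congˡ (zeroˡ y)) (+-identityʳ a))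

  adjoin-~ : ∀ I x a → x ~[ adjoin I (x + - a) ] a
  adjoin-~ I x a = x + - a , (0# , 1# , Ideal.0-mem I , sym (trans (+-identityˡ _) (*-identityˡ _))) ,
    sym (trans (+-comm a _) (trans (+-assoc x (- a) a) (trans (+-congˡ (-‿inverseˡ a)) (+-identityʳ x))))

  -- The ideal only grows along the list, so identifications made earlier persist; finitely many
  -- double negations compose.
  identify : ∀ (I : Ideal R) → Proper I → ∀ {n} (as : Vec Carrier n) xs → All (λ x → product as x ≈ 0#) xs →
    ¬ ¬ (Σ (Ideal R) λ J → Proper J × I ⊑ J × All (λ x → ∃[ k ] x ~[ J ] lookup as k) xs)
  identify I proper as []       []       none = none (I , proper , id , [])
  identify I proper as (x ∷ xs) (p ∷ ps) none =
    choose-root I proper as x (Ideal.resp I (sym p) (Ideal.0-mem I)) λ { (k , proper′) →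
    identify (adjoin I (x + - lookup as k)) proper′ as xs ps λ { (J , properJ , I⊑J , found) →
    none (J , properJ , (λ m → I⊑J (⊑-adjoin I _ m)) ,
      (k , ~-mono {adjoin I (x + - lookup as k)} {J} I⊑J (adjoin-~ I x (lookup as k))) ∷ found) } }

-- Finite integral domains

record FiniteDomain (n : ℕ) : Set where
  field
    add mul : Op₂ (Fin n)
    neg     : Op₁ (Fin n)
    zer one : Fin n
    isCommutativeRing : IsCommutativeRing _≡_ add mul neg zer one
    one≢zer  : one ≢ zer
    integral : ∀ x y → mul x y ≡ zer → x ≡ zer ⊎ y ≡ zer

-- Operations are stored as vectors rather than functions, because vectors over a finite set can be
-- searched exhaustively.
Table₁ Table₂ : ℕ → Set
Table₁ n = Vec (Fin n) n
Table₂ n = Vec (Vec (Fin n) n) n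

Laws : ∀ {n} → Table₂ n → Table₂ n → Table₁ n → Fin n → Fin n → Set
Laws addT mulT negT o l =
  (∀ a b c → add (add a b) c ≡ add a (add b c)) ×
  (∀ a b → add a b ≡ add b a) ×
  (∀ a → add o a ≡ a) ×
  (∀ a → add a (neg a) ≡ o) ×
  (∀ a b c → mul (mul a b) c ≡ mul a (mul b c)) ×
  (∀ a b → mul a b ≡ mul b a) ×
  (∀ a → mul l a ≡ a) ×
  (∀ a b c → mul a (add b c) ≡ add (mul a b) (mul a c)) ×
  l ≢ o ×
  (∀ a b → mul a b ≡ o → a ≡ o ⊎ b ≡ o)
  where
  add = λ a b → lookup (lookup addT a) b
  mul = λ a b → lookup (lookup mulT a) b
  neg = lookup negT

laws? : ∀ {n} addT mulT negT (o l : Fin n) → Dec (Laws addT mulT negT o l)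
laws? addT mulT negT o l =
  (all? λ a → all? λ b → all? λ c → _ ≟ _) ×-dec
  (all? λ a → all? λ b → _ ≟ _) ×-dec
  (all? λ a → _ ≟ _) ×-dec
  (all? λ a → _ ≟ _) ×-dec
  (all? λ a → all? λ b → all? λ c → _ ≟ _) ×-dec
  (all? λ a → all? λ b → _ ≟ _) ×-dec
  (all? λ a → _ ≟ _) ×-dec
  (all? λ a → all? λ b → all? λ c → _ ≟ _) ×-dec
  ¬? (l ≟ o) ×-dec
  (all? λ a → all? λ b → (_ ≟ o) →-dec ((a ≟ o) ⊎-dec (b ≟ o)))

Searchable : Set → Set₁
Searchable A = ∀ {P : A → Set} → (∀ a → Dec (P a)) → Dec (∃[ a ] P a)

search-Vec : ∀ {A} → Searchable A → ∀ n → Searchable (Vec A n)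
search-Vec search zero    P? = map′ ([] ,_) (λ { ([] , p) → p }) (P? [])
search-Vec search (suc n) P? = map′ (λ { (a , v , p) → a ∷ v , p }) (λ { (a ∷ v , p) → a , v , p })
  (search λ a → search-Vec search n λ v → P? (a ∷ v))

LawfulTables : ℕ → Set
LawfulTables n = ∃[ addT ] ∃[ mulT ] ∃[ negT ] ∃[ o ] ∃[ l ] Laws {n} addT mulT negT o l

lawfulTables? : ∀ n → Dec (LawfulTables n)
lawfulTables? n =
  search-Vec (search-Vec any? n) n λ addT → search-Vec (search-Vec any? n) n λ mulT →
  search-Vec any? n λ negT → any? λ o → any? λ l → laws? addT mulT negT o l

finiteDomain : ∀ {n} → LawfulTables n → FiniteDomain n
finiteDomain (addT , mulT , negT , o , l , +a , +c , +0 , +i , *a , *c , *1 , d , 1≢0 , int) = record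
  { isCommutativeRing = CommutativeRing.isCommutativeRing
      (mkRing ≡.isEquivalence (cong₂ _) (cong₂ _) (cong _) +a +c +0 +i *a *c *1 d)
  ; one≢zer = 1≢0 ; integral = int }

module _ (R : Ring) (nontrivial : Nontrivial R) where
  open CommutativeRing R hiding (zero)

  module _ {n}
    (ι : Fin n → Carrier) (ι-injective : ∀ i j → ι i ≈ ι j → i ≡ j)
    (has-0 : ∃[ k ] 0# ≈ ι k) (has-1 : ∃[ k ] 1# ≈ ι k)
    (has-+ : ∀ i j → ∃[ k ] ι i + ι j ≈ ι k) (has-* : ∀ i j → ∃[ k ] ι i * ι j ≈ ι k)
    (has-neg : ∀ i → ∃[ k ] - ι i ≈ ι k)
    (differences : ∀ i j → i ≢ j → ∃[ v ] v * (ι i + - ι j) ≈ 1#)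
    where
    private
      table : (Fin n → Fin n → Fin n) → Table₂ n
      table f = tabulate λ i → tabulate (f i)
      lookup-table : ∀ f i j → lookup (lookup (table f) i) j ≡ f i j
      lookup-table f i j rewrite lookup∘tabulate (λ i → tabulate (f i)) i = lookup∘tabulate (f i) j

      addT = table λ i j → proj₁ (has-+ i j)
      mulT = table λ i j → proj₁ (has-* i j)
      negT = tabulate λ i → proj₁ (has-neg i)
      o = proj₁ has-0
      l = proj₁ has-1

      add mul : Op₂ (Fin n)
      add a b = lookup (lookup addT a) b
      mul a b = lookup (lookup mulT a) b

      ι-add : ∀ i j → ι (add i j) ≈ ι i + ι j
      ι-add i j = trans (reflexive (cong ι (lookup-table _ i j))) (sym (proj₂ (has-+ i j)))
      ι-mul : ∀ i j → ι (mul i j) ≈ ι i * ι j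
      ι-mul i j = trans (reflexive (cong ι (lookup-table _ i j))) (sym (proj₂ (has-* i j)))
      ι-neg : ∀ i → ι (lookup negT i) ≈ - ι i
      ι-neg i = trans (reflexive (cong ι (lookup∘tabulate _ i))) (sym (proj₂ (has-neg i)))
      ι-0 : ι o ≈ 0#
      ι-0 = sym (proj₂ has-0)
      ι-1 : ι l ≈ 1#
      ι-1 = sym (proj₂ has-1)

      -- For `a` other than `o`, the difference `ι a + - ι o` is a unit and equals `ι a`, so it can
      -- be cancelled from the product.
      zero-product : ∀ a b → mul a b ≡ o → a ≡ o ⊎ b ≡ o
      zero-product a b e with a ≟ o
      ... | yes a≡o = inj₁ a≡o
      ... | no  a≢o with v , p ← differences a o a≢o = inj₂ (ι-injective b o
        (trans (trans (sym (*-identityˡ _)) (trans (*-congʳ (sym p)) (trans (*-assoc v _ _)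
          (trans (*-congˡ ab≈0) (zeroʳ v))))) (sym ι-0)))
        where
        open RingProperties ring using (-0#≈0#)
        ab≈0 : (ι a + - ι o) * ι b ≈ 0#
        ab≈0 = trans (*-congʳ (trans (+-congˡ (trans (-‿cong ι-0) -0#≈0#)) (+-identityʳ _)))
          (trans (sym (ι-mul a b)) (trans (reflexive (cong ι e)) ι-0))

    closed⇒lawfulTables : LawfulTables n
    closed⇒lawfulTables = addT , mulT , negT , o , l ,
      (λ a b c → ι-injective _ _ (trans (trans (ι-add _ c) (+-congʳ (ι-add a b)))
        (trans (+-assoc _ _ _) (sym (trans (ι-add a _) (+-congˡ (ι-add b c))))))) ,
      (λ a b → ι-injective _ _ (trans (ι-add a b) (trans (+-comm _ _) (sym (ι-add b a))))) ,
      (λ a → ι-injective _ _ (trans (ι-add o a) (trans (+-congʳ ι-0) (+-identityˡ _)))) ,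
      (λ a → ι-injective _ _ (trans (ι-add a _) (trans (+-congˡ (ι-neg a)) (trans (-‿inverseʳ _) (sym ι-0))))) ,
      (λ a b c → ι-injective _ _ (trans (trans (ι-mul _ c) (*-congʳ (ι-mul a b)))
        (trans (*-assoc _ _ _) (sym (trans (ι-mul a _) (*-congˡ (ι-mul b c))))))) ,
      (λ a b → ι-injective _ _ (trans (ι-mul a b) (trans (*-comm _ _) (sym (ι-mul b a))))) ,
      (λ a → ι-injective _ _ (trans (ι-mul l a) (trans (*-congʳ ι-1) (*-identityˡ _)))) ,
      (λ a b c → ι-injective _ _ (trans (trans (ι-mul a _) (*-congˡ (ι-add b c)))
        (trans (distribˡ _ _ _) (sym (trans (ι-add _ _) (+-cong (ι-mul a b) (ι-mul a c))))))) ,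
      (λ l≡o → nontrivial (trans (sym ι-1) (trans (reflexive (cong ι l≡o)) ι-0))) ,
      zero-product

-- Existence of a finite domain of prime power order

table : {A : Set} {m n : ℕ} → (Fin m → Fin n → A) → List A
table f = concat (List.tabulate λ i → List.tabulate (f i))

module _ {A : Set} {m n : ℕ} {P : A → Set} (f : Fin m → Fin n → A) where
  table⁺ : (∀ i j → P (f i j)) → All P (table f)
  table⁺ p = concat⁺ (tabulate⁺ λ i → tabulate⁺ (p i))

  table⁻ : All P (table f) → ∀ i j → P (f i j)
  table⁻ ps i = tabulate⁻ (tabulate⁻ {f = λ i → List.tabulate (f i)} (concat⁻ ps) i)

module PrimeField {π : ℕ} (π-prime : Prime π) where
  I : Ideal ℤₚ.+-*-commutativeRing
  I = adjoin (zeroIdeal ℤₚ.+-*-commutativeRing) (ℤ.+ π)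

  ℤ/π : Ring
  ℤ/π = quotient I

  ℤ/π-nontrivial : Nontrivial ℤ/π
  ℤ/π-nontrivial = quotient-nontrivial I λ { (_ , c , ≡.refl , p) → ¬prime[1] (subst Prime
    (∣1⇒≡1 (divides ℤ.∣ c ∣ (≡.trans (cong ℤ.∣_∣ (≡.trans p (ℤₚ.+-identityˡ (c ℤ.* ℤ.+ π)))) (ℤₚ.abs-* c (ℤ.+ π))))) π-prime) }

  open CommutativeRing ℤ/π hiding (zero)
  open Mult semiring using () renaming (_×_ to _·_)

  multiple-of-1 : ∀ n → n · 1# ≡ ℤ.+ n
  multiple-of-1 zero    = ≡.refl
  multiple-of-1 (suc n) = cong (ℤ._+_ ℤ.1ℤ) (multiple-of-1 n)

  ℤ/π-char : π · 1# ≈ 0#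
  ℤ/π-char = ℤ.+ π , (ℤ.0ℤ , ℤ.1ℤ , ≡.refl , ≡.sym (≡.trans (ℤₚ.+-identityˡ _) (ℤₚ.*-identityˡ _))) ,
    ≡.trans (multiple-of-1 π) (≡.sym (ℤₚ.+-identityˡ _))

module _ {π : ℕ} (π-prime : Prime π) where
  open PrimeField π-prime

  module _ {e k : ℕ} (e≢0 : NonZero e) (q≡ : 2 ℕ.+ k ≡ π ℕ.^ e) (S : Splitting ℤ/π (Xq-X.xq-x ℤ/π k)) where
    private
      module R₀ = CommutativeRing ℤ/π
      open Splitting S
      open CommutativeRing top hiding (zero)
      open Mult semiring using () renaming (_×_ to _·_)
      open Exp commutativeSemiring using (_^_)
      open Monic top
      open Xq-X top
      open Separate top
      open RingProperties ring using (-‿involutive; -1*x≈-x; x∙y⁻¹≈ε⇒x≈y)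
      open IsRingHomomorphism embed-hom using (⟦⟧-cong; +-homo; 0#-homo; 1#-homo; -‿homo)

      q = 2 ℕ.+ k

      embed-multiple : ∀ n → embed (Mult._×_ R₀.semiring n R₀.1#) ≈ n · 1#
      embed-multiple zero    = 0#-homo
      embed-multiple (suc n) = trans (+-homo _ _) (+-cong 1#-homo (embed-multiple n))

      char : π · 1# ≈ 0#
      char = trans (sym (embed-multiple π)) (trans (⟦⟧-cong ℤ/π-char) 0#-homo)

      open Frobenius top π-prime char
      open Fixed e k q≡

      char-q : q · 1# ≈ 0#
      char-q = char-× (subst (π ∣_) (≡.sym q≡) (π∣π^e e≢0)) 1#
        where
        π∣π^e : ∀ {e} → NonZero e → π ∣ π ℕ.^ e
        π∣π^e {suc e} _ = m∣m*n (π ℕ.^ e)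

      f≋ : map embed (Xq-X.xq-x ℤ/π k) ≋ xq-x k
      f≋ = 0#-homo ∷ trans (-‿homo R₀.1#) (-‿cong 1#-homo) ∷ zeros k
        where
        zeros : ∀ k → map embed (replicate k R₀.0#) ≋ replicate k 0#
        zeros zero    = []
        zeros (suc k) = 0#-homo ∷ zeros k

      product-roots : ∀ x → product roots x ≈ x ^ q + - x
      product-roots x = trans (sym (eval-split x)) (trans (eval-cong f≋ refl) (eval-xq-x k x))

      deriv-roots : ∀ x → deriv-product roots x ≈ - 1#
      deriv-roots x = trans (sym (deriv-split x)) (trans (deriv-cong f≋ refl) (deriv-xq-x k x char-q))

      fixed⇒root : ∀ {x} → x ^ q ≈ x → product roots x ≈ 0#
      fixed⇒root {x} p = trans (product-roots x) (trans (+-congʳ p) (-‿inverseʳ x))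

      a : Fin q → Carrier
      a = lookup roots

      a-fixed : ∀ i → a i ^ q ≈ a i
      a-fixed i = x∙y⁻¹≈ε⇒x≈y _ _ (trans (sym (product-roots (a i))) (product-root roots i))

      deriv-unit : ∀ i → Unit (deriv-product roots (a i))
      deriv-unit i = - 1# , trans (*-congˡ (deriv-roots (a i))) (trans (-1*x≈-x (- 1#)) (-‿involutive 1#))

      sums products negatives targets : List Carrier
      sums      = table λ i j → a i + a j
      products  = table λ i j → a i * a j
      negatives = List.tabulate λ i → - a i
      targets   = 0# ∷ 1# ∷ negatives ++ sums ++ products

      -- The fixed points of x ↦ x^q form a subring containing all aₖ. With zero divisors around, a
      -- root of ∏ (X - aₖ) need not be one of the aₖ, which is why an ideal has to identify these
      -- elements with some aₖ.
      targets-roots : All (λ x → product roots x ≈ 0#) targets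
      targets-roots = fixed⇒root fixed-0 ∷ fixed⇒root fixed-1 ∷
        ++⁺ (tabulate⁺ λ i → fixed⇒root (fixed-neg (a-fixed i)))
        (++⁺ (table⁺ _ λ i j → fixed⇒root (fixed-+ (a-fixed i) (a-fixed j)))
             (table⁺ _ λ i j → fixed⇒root (fixed-* (a-fixed i) (a-fixed j))))

      fromIdeal : ∀ (J : Ideal top) → Proper J → All (λ x → ∃[ i ] x ~[ J ] a i) targets → LawfulTables q
      fromIdeal J proper (z ∷ o ∷ rest) = closed⇒lawfulTables (quotient J) (quotient-nontrivial J proper) a
        injective z o
        (table⁻ (λ i j → a i + a j) (proj₁ rest₂))
        (table⁻ (λ i j → a i * a j) (proj₂ rest₂))
        (tabulate⁻ (proj₁ rest₁))
        λ i j i≢j → let v , p = units-apart roots deriv-unit i j i≢j in v , ≈⇒quotient p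
        where
        rest₁ = ++⁻ negatives rest
        rest₂ = ++⁻ sums (proj₂ rest₁)
        ≈⇒quotient : ∀ {x y} → x ≈ y → x ~[ J ] y
        ≈⇒quotient = IsRingHomomorphism.⟦⟧-cong (quotient-hom J)
        injective : ∀ i j → a i ~[ J ] a j → i ≡ j
        injective i j e with i ≟ j
        ... | yes i≡j = i≡j
        ... | no  i≢j = ⊥-elim (proper⇒¬unit J proper (units-apart roots deriv-unit i j i≢j) e)

    splitting⇒finiteDomain : FiniteDomain q
    splitting⇒finiteDomain = finiteDomain (decidable-stable (lawfulTables? q) λ none →
      identify (zeroIdeal top) nontrivial roots targets targets-roots λ { (J , proper , _ , found) →
      none (fromIdeal J proper found) })

finiteDomain-exists : ∀ {π e k} → Prime π → NonZero e → 2 ℕ.+ k ≡ π ℕ.^ e → FiniteDomain (2 ℕ.+ k)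
finiteDomain-exists {k = k} π-prime e≢0 q≡ =
  splitting⇒finiteDomain π-prime e≢0 q≡ (splitting ℤ/π ℤ/π-nontrivial (Xq-X.xq-x ℤ/π k))
  where open PrimeField π-prime

open import Relation.Binary.PropositionalEquality using (refl; sym; trans)

-- Sums over finite types

open Sum ℕₚ.+-*-semiring using (sum; sum-cong-≗; ∑-distrib-+; ∑-comm; *-distribˡ-sum; sum-remove; sum-permute)

sum-const : ∀ n c → sum {n} (λ _ → c) ≡ n ℕ.* c
sum-const zero    c = refl
sum-const (suc n) c = cong (c ℕ.+_) (sum-const n c)

sum-splitAt : ∀ m {n} (f : Fin m ⊎ Fin n → ℕ) →
  sum (f ∘ splitAt m) ≡ sum (f ∘ inj₁) ℕ.+ sum (f ∘ inj₂)
sum-splitAt zero    f = refl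
sum-splitAt (suc m) f = trans (cong (f (inj₁ zero) ℕ.+_) (sum-splitAt m (f ∘ Sum⊎.map suc id)))
  (sym (ℕₚ.+-assoc (f (inj₁ zero)) _ _))

sum-remQuot : ∀ m n (f : Fin m × Fin n → ℕ) →
  sum (f ∘ remQuot {m} n) ≡ sum λ i → sum λ j → f (i , j)
sum-remQuot zero    n f = refl
sum-remQuot (suc m) n f = trans (sum-cong-≗ (λ i → case (splitAt n i) refl))
  (trans (sum-splitAt n g) (cong (sum (λ j → f (zero , j)) ℕ.+_) (sum-remQuot m n (f ∘ map₁ suc))))
  where
  g : Fin n ⊎ Fin (m ℕ.* n) → ℕ
  g = [ (λ j → f (zero , j)) , (λ k → f (map₁ suc (remQuot {m} n k))) ]′
  case : ∀ {i} x → splitAt n i ≡ x → f (remQuot {suc m} n i) ≡ g x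
  case (inj₁ j) eq rewrite eq = refl
  case (inj₂ k) eq rewrite eq = refl

record Finite (A : Set) : Set where
  field
    size  : ℕ
    enum  : Fin size → A
    index : A → Fin size
    index-enum : ∀ i → index (enum i) ≡ i

  enum-injective : ∀ {i j} → enum i ≡ enum j → i ≡ j
  enum-injective {i} {j} e = trans (sym (index-enum i)) (trans (cong index e) (index-enum j))

  ∑ : (A → ℕ) → ℕ
  ∑ f = sum (f ∘ enum)

  ∑-cong : ∀ {f g : A → ℕ} → (∀ a → f a ≡ g a) → ∑ f ≡ ∑ g
  ∑-cong e = sum-cong-≗ (e ∘ enum)

  ∑-* : ∀ c f → ∑ (λ a → c ℕ.* f a) ≡ c ℕ.* ∑ f
  ∑-* c f = sym (*-distribˡ-sum c (f ∘ enum))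

  ∑-const : ∀ c → ∑ (λ _ → c) ≡ size ℕ.* c
  ∑-const = sum-const size

open Finite using (size; enum; ∑; ∑-cong; ∑-*; ∑-const)

∑-swap : ∀ {A B} (a : Finite A) (b : Finite B) (f : A → B → ℕ) →
  ∑ a (λ x → ∑ b (f x)) ≡ ∑ b (λ y → ∑ a λ x → f x y)
∑-swap a b f = ∑-comm (λ i j → f (enum a i) (enum b j))

Fin-finite : ∀ n → Finite (Fin n)
Fin-finite n = record { size = n ; enum = id ; index = id ; index-enum = λ _ → refl }

⊤-finite : Finite ⊤
⊤-finite = record { size = 1 ; enum = λ _ → tt ; index = λ _ → zero ; index-enum = λ { zero → refl } }

⊥-finite : Finite ⊥
⊥-finite = record { size = 0 ; enum = λ () ; index = λ () ; index-enum = λ () }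

infixr 1 _⊎-finite_
_⊎-finite_ : ∀ {A B} → Finite A → Finite B → Finite (A ⊎ B)
a ⊎-finite b = record
  { size = size a ℕ.+ size b
  ; enum = Sum⊎.map (enum a) (enum b) ∘ splitAt (size a)
  ; index = join (size a) (size b) ∘ Sum⊎.map (Finite.index a) (Finite.index b)
  ; index-enum = λ i → trans (cong (join (size a) (size b)) (cancel (splitAt (size a) i))) (join-splitAt (size a) (size b) i) }
  where
  cancel : ∀ x → Sum⊎.map (Finite.index a) (Finite.index b) (Sum⊎.map (enum a) (enum b) x) ≡ x
  cancel (inj₁ i) = cong inj₁ (Finite.index-enum a i)
  cancel (inj₂ i) = cong inj₂ (Finite.index-enum b i)

infixr 2 _×-finite_
_×-finite_ : ∀ {A B} → Finite A → Finite B → Finite (A × B)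
a ×-finite b = record
  { size = size a ℕ.* size b
  ; enum = λ i → enum a (proj₁ (remQuot {size a} (size b) i)) , enum b (proj₂ (remQuot {size a} (size b) i))
  ; index = λ { (x , y) → combine (Finite.index a x) (Finite.index b y) }
  ; index-enum = λ i → trans (cong₂ combine (Finite.index-enum a _) (Finite.index-enum b _)) (combine-remQuot {size a} (size b) i) }

∑-⊎ : ∀ {A B} (a : Finite A) (b : Finite B) f → ∑ (a ⊎-finite b) f ≡ ∑ a (f ∘ inj₁) ℕ.+ ∑ b (f ∘ inj₂)
∑-⊎ a b f = sum-splitAt (size a) (f ∘ Sum⊎.map (enum a) (enum b))

∑-× : ∀ {A B} (a : Finite A) (b : Finite B) f → ∑ (a ×-finite b) f ≡ ∑ a λ x → ∑ b λ y → f (x , y)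
∑-× a b f = sum-remQuot (size a) (size b) λ { (i , j) → f (enum a i , enum b j) }

-- Pigeonhole: if `y` were missed, punching it out would inject `suc n` elements into n.
injective⇒surjective : ∀ {n} (f : Fin n → Fin n) → Injective _≡_ _≡_ f → ∀ y → ∃[ x ] f x ≡ y
injective⇒surjective {suc n} f inj y with any? (λ x → f x ≟ y)
... | yes found = found
... | no  none  = ⊥-elim (ℕₚ.1+n≰n (injective⇒≤ {f = λ x → punchOut (y≢f x)}
    (λ e → inj (punchOut-injective (y≢f _) (y≢f _) e))))
  where
  y≢f : ∀ x → y ≢ f x
  y≢f x y≡fx = none (x , sym y≡fx)

injective⇒permutation : ∀ {n} (f : Fin n → Fin n) → Injective _≡_ _≡_ f → Permutation n n
injective⇒permutation f inj = permutation f g (proj₂ ∘ surj) (λ x → inj (proj₂ (surj (f x))))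
  where
  surj = injective⇒surjective f inj
  g = proj₁ ∘ surj

sum-injective : ∀ {n} (f : Fin n → ℕ) (s : Fin n → Fin n) → Injective _≡_ _≡_ s → sum (f ∘ s) ≡ sum f
sum-injective f s inj = sym (sum-permute f (injective⇒permutation s inj))

sum-except : ∀ {n} (f : Fin (suc n) → ℕ) i c → (∀ j → j ≢ i → f j ≡ c) → sum f ≡ f i ℕ.+ n ℕ.* c
sum-except {n} f i c e = trans (sum-remove {i = i} f)
  (cong (f i ℕ.+_) (trans (sum-cong-≗ (λ j → e (punchIn i j) (punchInᵢ≢i i j))) (sum-const n c)))

-- Arithmetic in a finite domain

domainRing : ∀ {n} → FiniteDomain n → Ring
domainRing F = record { isCommutativeRing = FiniteDomain.isCommutativeRing F }

module Domain {r : ℕ} (F : FiniteDomain (suc r)) where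
  q : ℕ
  q = suc r

  open CommutativeRing (domainRing F) public using (_+_; _*_; -_; 0#; 1#)
  open CommutativeRing (domainRing F) using
    (ring; semiring; +-identityˡ; +-identityʳ; -‿inverseʳ; distribˡ)
  open FiniteDomain F using (integral; one≢zer)
  open RingProperties ring using (x∙y⁻¹≈ε⇒x≈y; +-cancelʳ; -‿distribʳ-*)

  *-nonzero : ∀ {x y} → x ≢ 0# → y ≢ 0# → x * y ≢ 0#
  *-nonzero {x} {y} x≢0 y≢0 e with integral x y e
  ... | inj₁ x≡0 = x≢0 x≡0
  ... | inj₂ y≡0 = y≢0 y≡0

  *-injective : ∀ {c} → c ≢ 0# → Injective _≡_ _≡_ (c *_)
  *-injective {c} c≢0 {x} {y} e with integral c (x + - y)
    (trans (distribˡ c x (- y)) (trans (cong₂ _+_ e (sym (-‿distribʳ-* c y))) (-‿inverseʳ (c * y))))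
  ... | inj₁ c≡0 = ⊥-elim (c≢0 c≡0)
  ... | inj₂ d≡0 = x∙y⁻¹≈ε⇒x≈y x y d≡0

  -- Finiteness turns cancellation into division, so the domain is a field.
  divide : ∀ {c} → c ≢ 0# → ∀ x → ∃[ y ] c * y ≡ x
  divide {c} c≢0 = injective⇒surjective (c *_) (*-injective c≢0)

  sum-shift : ∀ (g : Fin q → ℕ) c → sum (λ x → g (x + c)) ≡ sum g
  sum-shift g c = sum-injective g (_+ c) (λ {x} {y} → +-cancelʳ c x y)

  sum-scale : ∀ (g : Fin q → ℕ) {c} → c ≢ 0# → sum (λ x → g (c * x)) ≡ sum g
  sum-scale g {c} c≢0 = sum-injective g (c *_) (*-injective c≢0)

  -- Summing x and x + 1 over the domain shows that q · 1 = 0.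
  1+1≢0 : ∀ h → r ≡ 2 ℕ.* h → 1# + 1# ≢ 0#
  1+1≢0 h r≡2h 2≡0 = one≢zer (trans (sym (+-identityʳ 1#)) (trans (cong (1# +_) (sym even)) q·1≡0))
    where
    open Mult semiring using (×-assocˡ) renaming (_×_ to _·_)
    module S = Sum semiring
    q·1≡0 : q · 1# ≡ 0#
    q·1≡0 = RingProperties.+-cancelˡ ring (S.sum id) _ _ (trans (trans (cong (S.sum id +_) (sym (S.sum-replicate q)))
      (sym (S.∑-distrib-+ id (λ _ → 1#))))
      (trans (sym (S.sum-permute id (injective⇒permutation (_+ 1#) (λ {x} {y} → +-cancelʳ 1# x y)))) (sym (+-identityʳ _))))
    even : r · 1# ≡ 0#
    even = trans (cong (_· 1#) (trans r≡2h (ℕₚ.*-comm 2 h))) (trans (sym (×-assocˡ 1# h 2)) (trans (cong (h ·_)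
      (trans (cong (1# +_) (+-identityʳ 1#)) 2≡0)) (zeros h)))
      where
      zeros : ∀ n → n · 0# ≡ 0#
      zeros zero    = refl
      zeros (suc n) = trans (+-identityˡ _) (zeros n)

-- The quadratic character

module Character {r : ℕ} (F : FiniteDomain (suc r)) (h : ℕ) (r≡2h : r ≡ 2 ℕ.* h) where
  open Domain F
  open FiniteDomain F using (integral; one≢zer)
  open CommutativeRing (domainRing F) using
    (ring; commutativeSemiring; +-identityˡ; -‿inverseʳ; *-comm; *-identityˡ; zeroˡ; zeroʳ; distribʳ)
  open RingProperties ring using (-‿involutive; -0#≈0#; -1*x≈-x; -‿distribˡ-*; x∙y⁻¹≈ε⇒x≈y; +-inverseˡ-unique)
  open SemiringSolver commutativeSemiring using (solve; _:=_; _:+_; _:*_)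

  IsSquare : Fin q → Set
  IsSquare x = ∃[ t ] t * t ≡ x

  isSquare? : ∀ x → Dec (IsSquare x)
  isSquare? x = any? λ t → t * t ≟ x

  ≡-neg⇒0 : ∀ {x} → x ≡ - x → x ≡ 0#
  ≡-neg⇒0 {x} e with integral (1# + 1#) x
    (trans (distribʳ x 1# 1#) (trans (cong₂ _+_ (*-identityˡ x) (trans (*-identityˡ x) e)) (-‿inverseʳ x)))
  ... | inj₁ 2≡0 = ⊥-elim (1+1≢0 h r≡2h 2≡0)
  ... | inj₂ x≡0 = x≡0

  square-roots : ∀ {x y} → x * x ≡ y * y → x ≡ y ⊎ x ≡ - y
  square-roots {x} {y} e with integral (x + - y) (x + y) difference
    where
    difference : (x + - y) * (x + y) ≡ 0#
    difference = trans (solve 3 (λ x y z → (x :+ z) :* (x :+ y) := (x :* x :+ z :* y) :+ x :* (y :+ z)) refl x y (- y))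
      (trans (cong₂ _+_ (trans (cong₂ _+_ e (sym (-‿distribˡ-* y y))) (-‿inverseʳ (y * y)))
        (trans (cong (x *_) (-‿inverseʳ y)) (zeroʳ x))) (+-identityˡ 0#))
  ... | inj₁ d = inj₁ (x∙y⁻¹≈ε⇒x≈y x y d)
  ... | inj₂ s = inj₂ (+-inverseˡ-unique x y s)

  private
    -1² : - 1# * - 1# ≡ 1# * 1#
    -1² = trans (-1*x≈-x (- 1#)) (trans (-‿involutive 1#) (sym (*-identityˡ 1#)))

  -- If every element had a square root, choosing roots would be injective, hence surjective. Then 1
  -- and -1 would both be chosen roots, and of the same element 1, so 1 = -1.
  nonsquare : ∃[ n ] ¬ IsSquare n
  nonsquare = ¬∀⟶∃¬ q IsSquare isSquare? all-squares-absurd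
    where
    all-squares-absurd : ¬ (∀ n → IsSquare n)
    all-squares-absurd root = one≢zer (≡-neg⇒0 (trans (sym (proj₂ at-1)) (trans (cong s same) (proj₂ at--1))))
      where
      s : Fin q → Fin q
      s n = proj₁ (root n)
      s-injective : Injective _≡_ _≡_ s
      s-injective {x} {y} e = trans (sym (proj₂ (root x))) (trans (cong (λ t → t * t) e) (proj₂ (root y)))
      at-1 = injective⇒surjective s s-injective 1#
      at--1 = injective⇒surjective s s-injective (- 1#)
      square : ∀ {t} (p : ∃[ n ] s n ≡ t) → proj₁ p ≡ t * t
      square (n , sn≡t) = trans (sym (proj₂ (root n))) (cong (λ t → t * t) sn≡t)
      same : proj₁ at-1 ≡ proj₁ at--1
      same = trans (square at-1) (trans (sym -1²) (sym (square at--1)))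

  n₀ : Fin q
  n₀ = proj₁ nonsquare

  n₀-nonsquare : ¬ IsSquare n₀
  n₀-nonsquare = proj₂ nonsquare

  n₀≢0 : n₀ ≢ 0#
  n₀≢0 e = n₀-nonsquare (0# , trans (zeroˡ 0#) (sym e))

  square-quotient : ∀ {x y} → x ≢ 0# → IsSquare x → IsSquare (x * y) → IsSquare y
  square-quotient {y = y} x≢0 (t , refl) (u , uu≡tty) = v , *-injective x≢0
    (trans (solve 2 (λ t v → t :* t :* (v :* v) := (t :* v) :* (t :* v)) refl t v) (trans (cong₂ _*_ tv≡u tv≡u) uu≡tty))
    where
    t≢0 : t ≢ 0#
    t≢0 e = x≢0 (trans (cong (_* t) e) (zeroˡ t))
    v = proj₁ (divide t≢0 u)
    tv≡u = proj₂ (divide t≢0 u)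

  -- y ↦ y² on one half of the domain and y ↦ n₀ y² on the other half (exchanged by
  -- negation) is injective, hence surjective: every nonsquare is n₀ times a square.
  private
    half : ∀ y → Dec (y < - y) → Fin q
    half y (yes _) = y * y
    half y (no _)  = n₀ * (y * y)

    not-both : ∀ y z → y < - y → z < - z → y ≡ - z → ⊥
    not-both y z y<-y z<-z refl = <-asym z<-z (subst (- z <_) (-‿involutive z) y<-y)

    neither : ∀ y z → ¬ y < - y → ¬ z < - z → y ≡ - z → y ≡ z
    neither y z ¬y<-y ¬z<-z refl with <-cmp z (- z)
    ... | tri< z<-z _ _ = ⊥-elim (¬z<-z z<-z)
    ... | tri≈ _ z≡-z _ = sym z≡-z
    ... | tri> _ _ -z<z = ⊥-elim (¬y<-y (subst (- z <_) (sym (-‿involutive z)) -z<z))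

    -- If z is nonzero, n₀ would be a quotient of squares; if z = 0 then y = 0, which is not below
    -- its own negative.
    mixed : ∀ y z → y < - y → y * y ≢ n₀ * (z * z)
    mixed y z y<-y e with z ≟ 0#
    ... | yes refl = <-irrefl (trans y≡0 (trans (sym -0#≈0#) (cong -_ (sym y≡0)))) y<-y
      where
      y≡0 : y ≡ 0#
      y≡0 = [ id , id ]′ (integral y y (trans e (trans (cong (n₀ *_) (zeroˡ 0#)) (zeroʳ n₀))))
    ... | no z≢0 = n₀-nonsquare (square-quotient (*-nonzero z≢0 z≢0) (z , refl) (y , trans e (*-comm n₀ (z * z))))

    half-injective : ∀ y z d e → half y d ≡ half z e → y ≡ z
    half-injective y z (yes y<-y) (yes z<-z) eq =
      [ id , (λ y≡-z → ⊥-elim (not-both y z y<-y z<-z y≡-z)) ]′ (square-roots eq)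
    half-injective y z (yes y<-y) (no _)     eq = ⊥-elim (mixed y z y<-y eq)
    half-injective y z (no _)     (yes z<-z) eq = ⊥-elim (mixed z y z<-z (sym eq))
    half-injective y z (no ¬y<-y) (no ¬z<-z) eq =
      [ id , neither y z ¬y<-y ¬z<-z ]′ (square-roots (*-injective n₀≢0 eq))

  nonsquare-form : ∀ {x} → ¬ IsSquare x → ∃[ y ] n₀ * (y * y) ≡ x
  nonsquare-form {x} ¬sq = go (proj₁ image) (proj₁ image <? - proj₁ image) (proj₂ image)
    where
    image = injective⇒surjective (λ y → half y (y <? - y)) (λ {y} {z} → half-injective y z (y <? - y) (z <? - z)) x
    go : ∀ y d → half y d ≡ x → ∃[ y ] n₀ * (y * y) ≡ x
    go y (yes _) e = ⊥-elim (¬sq (y , e))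
    go y (no _)  e = y , e

  -- `true` stands for the sign -1, so that multiplying signs is `xor`. The value at zero is `false`
  -- and gets masked in `σ`.
  χ : Fin q → Bool
  χ x = not (does (isSquare? x))

  -- Closure of squares under products and quotients settles all cases but two nonsquares, where
  -- n₀s² · n₀t² = (n₀st)².
  χ-* : ∀ {x y} → x ≢ 0# → y ≢ 0# → χ (x * y) ≡ χ x xor χ y
  χ-* {x} {y} x≢0 y≢0 = go (isSquare? x) (isSquare? y) (isSquare? (x * y))
    where
    go : (p : Dec (IsSquare x)) (q : Dec (IsSquare y)) (pq : Dec (IsSquare (x * y))) →
      not (does pq) ≡ not (does p) xor not (does q)
    go (yes _)          (yes _)          (yes _)  = refl
    go (yes (s , ss≡x)) (yes (t , tt≡y)) (no ¬pq) = ⊥-elim (¬pq (s * t ,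
      trans (solve 2 (λ s t → (s :* t) :* (s :* t) := s :* s :* (t :* t)) refl s t) (cong₂ _*_ ss≡x tt≡y)))
    go (yes p) (no ¬q) (yes pq) = ⊥-elim (¬q (square-quotient x≢0 p pq))
    go (yes _) (no _)  (no _)   = refl
    go (no ¬p) (yes q) (yes pq) = ⊥-elim (¬p (square-quotient y≢0 q (subst IsSquare (*-comm x y) pq)))
    go (no _)  (yes _) (no _)   = refl
    go (no _)  (no _)  (yes _)  = refl
    go (no ¬p) (no ¬q) (no ¬pq) with nonsquare-form ¬p | nonsquare-form ¬q
    ... | s , nss≡x | t , ntt≡y = ⊥-elim (¬pq (n₀ * (s * t) , trans
      (solve 3 (λ n s t → (n :* (s :* t)) :* (n :* (s :* t)) := (n :* (s :* s)) :* (n :* (t :* t))) refl n₀ s t)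
      (cong₂ _*_ nss≡x ntt≡y)))

  χ-n₀ : χ n₀ ≡ true
  χ-n₀ = go (isSquare? n₀)
    where
    go : (p : Dec (IsSquare n₀)) → not (does p) ≡ true
    go (yes p) = ⊥-elim (n₀-nonsquare p)
    go (no _)  = refl

-- V m is the space Fᵐ and P m its projective space, each point being represented by
-- the vector whose first nonzero coordinate is 1.

module Geometry {r : ℕ} (F : FiniteDomain (suc r)) where
  open Domain F
  open FiniteDomain F using (one≢zer)
  open CommutativeRing (domainRing F) using
    (ring; commutativeSemiring; +-assoc; +-identityˡ; +-identityʳ; -‿inverseˡ; *-identityʳ; zeroˡ; zeroʳ)
  open RingProperties ring using (x∙y⁻¹≈ε⇒x≈y)
  open SemiringSolver commutativeSemiring using (solve; _:=_; _:+_; _:*_)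

  V P : ℕ → Set
  V zero    = ⊤
  V (suc m) = Fin q × V m
  P zero    = ⊥
  P (suc m) = V m ⊎ P m

  V-finite : ∀ m → Finite (V m)
  V-finite zero    = ⊤-finite
  V-finite (suc m) = Fin-finite q ×-finite V-finite m

  P-finite : ∀ m → Finite (P m)
  P-finite zero    = ⊥-finite
  P-finite (suc m) = V-finite m ⊎-finite P-finite m

  ∑V : ∀ {m} → (V m → ℕ) → ℕ
  ∑V {m} = ∑ (V-finite m)

  ∑P : ∀ {m} → (P m → ℕ) → ℕ
  ∑P {m} = ∑ (P-finite m)

  V-size : ∀ m → size (V-finite m) ≡ q ℕ.^ m
  V-size zero    = refl
  V-size (suc m) = cong (q ℕ.*_) (V-size m)

  origin : ∀ {m} → V m
  origin {zero}  = tt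
  origin {suc m} = 0# , origin

  scale : ∀ {m} → Fin q → V m → V m
  scale {zero}  c v       = tt
  scale {suc m} c (x , v) = c * x , scale c v

  subtract : ∀ {m} → V m → V m → V m
  subtract {zero}  v       w       = tt
  subtract {suc m} (x , v) (y , w) = x + - y , subtract v w

  dot : ∀ {m} → V m → V m → Fin q
  dot {zero}  v       w       = 0#
  dot {suc m} (x , v) (y , w) = x * y + dot v w

  vector : ∀ {m} → P m → V m
  vector {suc m} (inj₁ v) = 1# , v
  vector {suc m} (inj₂ i) = 0# , vector i

  vector≢origin : ∀ {m} (i : P m) → vector i ≢ origin
  vector≢origin {suc m} (inj₁ v) e = one≢zer (cong proj₁ e)
  vector≢origin {suc m} (inj₂ i) e = vector≢origin i (cong proj₂ e)

  dot-origin : ∀ {m} (w : V m) → dot w origin ≡ 0#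
  dot-origin {zero}  w       = refl
  dot-origin {suc m} (x , w) = trans (cong₂ _+_ (zeroʳ x) (dot-origin w)) (+-identityˡ 0#)

  dot-scale : ∀ {m} c (w v : V m) → dot w (scale c v) ≡ c * dot w v
  dot-scale {zero}  c w       v       = sym (zeroʳ c)
  dot-scale {suc m} c (x , w) (y , v) = trans (cong (x * (c * y) +_) (dot-scale c w v))
    (solve 4 (λ c x y d → x :* (c :* y) :+ c :* d := c :* (x :* y :+ d)) refl c x y (dot w v))

  dot-subtract : ∀ {m} (u w v : V m) → dot u v ≡ dot (subtract u w) v + dot w v
  dot-subtract {zero}  u       w       v       = sym (+-identityˡ 0#)
  dot-subtract {suc m} (x , u) (y , w) (z , v) = trans (cong₂ _+_
      (cong (_* z) (trans (sym (+-identityʳ x)) (trans (cong (x +_) (sym (-‿inverseˡ y))) (sym (+-assoc x (- y) y)))))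
      (dot-subtract u w v))
    (solve 5 (λ x y z d e → (x :+ y) :* z :+ (d :+ e) := (x :* z :+ d) :+ (y :* z :+ e)) refl
      (x + - y) y z (dot (subtract u w) v) (dot w v))

  subtract≢origin : ∀ {m} {u w : V m} → u ≢ w → subtract u w ≢ origin
  subtract≢origin {m} {u} {w} u≢w e = u≢w (go m u w e)
    where
    go : ∀ m (u w : V m) → subtract u w ≡ origin → u ≡ w
    go zero    u       w       e = refl
    go (suc m) (x , u) (y , w) e = cong₂ _,_ (x∙y⁻¹≈ε⇒x≈y x y (cong proj₁ e)) (go m u w (cong proj₂ e))

  P-≟ : ∀ {m} (i j : P m) → Dec (i ≡ j)
  P-≟ {suc m} = Sum⊎ₚ.≡-dec V-≟ P-≟
    where
    V-≟ : ∀ {m} (v w : V m) → Dec (v ≡ w)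
    V-≟ {zero}  v w = yes refl
    V-≟ {suc m} = Productₚ.≡-dec _≟_ V-≟

  ∑V-scale : ∀ {m} (g : V m → ℕ) {c} → c ≢ 0# → ∑V (g ∘ scale c) ≡ ∑V g
  ∑V-scale {zero}  g c≢0 = refl
  ∑V-scale {suc m} g {c} c≢0 = trans (∑-× (Fin-finite q) (V-finite m) (g ∘ scale c)) (trans
    (sum-cong-≗ λ x → ∑V-scale (λ v → g (c * x , v)) c≢0) (trans
    (sum-scale (λ x → ∑V λ v → g (x , v)) c≢0) (sym (∑-× (Fin-finite q) (V-finite m) g))))

  -- Every vector other than the origin is a multiple of exactly one representative.
  ∑V-lines : ∀ {m} (g : V m → ℕ) → (∀ {c} v → c ≢ 0# → g (scale c v) ≡ g v) →
    ∑V g ≡ g origin ℕ.+ r ℕ.* ∑P (g ∘ vector)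
  ∑V-lines {zero}  g inv = cong (g tt ℕ.+_) (sym (ℕₚ.*-zeroʳ r))
  ∑V-lines {suc m} g inv = begin
    ∑V g
      ≡⟨ ∑-× (Fin-finite q) (V-finite m) g ⟩
    sum (λ x → ∑V λ v → g (x , v))
      ≡⟨ sum-except _ 0# (∑V λ v → g (1# , v)) affine ⟩
    (∑V λ v → g (0# , v)) ℕ.+ r ℕ.* (∑V λ v → g (1# , v))
      ≡⟨ cong (ℕ._+ r ℕ.* (∑V λ v → g (1# , v))) (∑V-lines (λ v → g (0# , v)) at-infinity) ⟩
    g origin ℕ.+ r ℕ.* ∑P (λ i → g (0# , vector i)) ℕ.+ r ℕ.* (∑V λ v → g (1# , v))
      ≡⟨ S.solve 4 (λ o r a b → o S.:+ r S.:* a S.:+ r S.:* b S.:= o S.:+ r S.:* (b S.:+ a)) refl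
           (g origin) r (∑P λ i → g (0# , vector i)) (∑V λ v → g (1# , v)) ⟩
    g origin ℕ.+ r ℕ.* ((∑V λ v → g (1# , v)) ℕ.+ ∑P (λ i → g (0# , vector i)))
      ≡⟨ cong (λ s → g origin ℕ.+ r ℕ.* s) (∑-⊎ (V-finite m) (P-finite m) (g ∘ vector)) ⟨
    g origin ℕ.+ r ℕ.* ∑P (g ∘ vector) ∎
    where
    open ≡-Reasoning
    module S = +-*-Solver
    affine : ∀ x → x ≢ 0# → (∑V λ v → g (x , v)) ≡ ∑V λ v → g (1# , v)
    affine x x≢0 = trans (sym (∑V-scale (λ v → g (x , v)) x≢0))
      (∑-cong (V-finite m) λ v → trans (cong (λ y → g (y , scale x v)) (sym (*-identityʳ x))) (inv (1# , v) x≢0))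
    at-infinity : ∀ {c} v → c ≢ 0# → g (0# , scale c v) ≡ g (0# , v)
    at-infinity {c} v c≢0 = trans (cong (λ y → g (y , scale c v)) (sym (zeroʳ c))) (inv (0# , v) c≢0)

  ∑V-line : ∀ {m} (g : Fin q → V m → ℕ) →
    ∑V {suc m} (λ { (x , v) → g x v }) ≡ ∑V λ v → sum λ x → g x v
  ∑V-line {m} g = trans (∑-× (Fin-finite q) (V-finite m) (λ { (x , v) → g x v })) (∑-swap (Fin-finite q) (V-finite m) g)

  sum-affine : ∀ (f : Fin q → ℕ) {a} b → a ≢ 0# → sum (λ x → f (a * x + b)) ≡ sum f
  sum-affine f {a} b a≢0 = trans (sum-scale (λ x → f (x + b)) a≢0) (sum-shift f b)

  -- At the first nonzero coordinate a of `w`, the map x ↦ ax + d permutes the domain, which makes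
  -- the product uniform; a zero coordinate only contributes a factor q.
  dot-uniform : ∀ {m} (w : V m) → w ≢ origin → ∀ f → q ℕ.* ∑V (λ v → f (dot w v)) ≡ q ℕ.^ m ℕ.* sum f
  dot-uniform {zero}  w       w≢0 f = ⊥-elim (w≢0 refl)
  dot-uniform {suc m} (a , w) w≢0 f with a ≟ 0#
  ... | no a≢0 = begin
    q ℕ.* ∑V (λ v → f (dot (a , w) v))
      ≡⟨ cong (q ℕ.*_) (trans (∑V-line λ x v → f (a * x + dot w v)) (trans
          (∑-cong (V-finite m) λ v → sum-affine f (dot w v) a≢0) (∑-const (V-finite m) (sum f)))) ⟩
    q ℕ.* (size (V-finite m) ℕ.* sum f)
      ≡⟨ ℕₚ.*-assoc q (size (V-finite m)) (sum f) ⟨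
    q ℕ.* size (V-finite m) ℕ.* sum f
      ≡⟨ cong (λ n → q ℕ.* n ℕ.* sum f) (V-size m) ⟩
    q ℕ.^ suc m ℕ.* sum f ∎
    where open ≡-Reasoning
  ... | yes a≡0 = begin
    q ℕ.* ∑V (λ v → f (dot (a , w) v))
      ≡⟨ cong (q ℕ.*_) (trans (∑V-line λ x v → f (a * x + dot w v)) (trans
          (∑-cong (V-finite m) λ v → trans (sum-cong-≗ λ x → cong f (vanish x (dot w v))) (sum-const q (f (dot w v))))
          (∑-* (V-finite m) q (λ v → f (dot w v))))) ⟩
    q ℕ.* (q ℕ.* ∑V (λ v → f (dot w v)))
      ≡⟨ cong (q ℕ.*_) (dot-uniform w (λ w≡0 → w≢0 (cong₂ _,_ a≡0 w≡0)) f) ⟩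
    q ℕ.* (q ℕ.^ m ℕ.* sum f)
      ≡⟨ ℕₚ.*-assoc q (q ℕ.^ m) (sum f) ⟨
    q ℕ.^ suc m ℕ.* sum f ∎
    where
    open ≡-Reasoning
    vanish : ∀ x d → a * x + d ≡ d
    vanish x d = trans (cong (_+ d) (trans (cong (_* x) a≡0) (zeroˡ x))) (+-identityˡ d)

  sum² : (Fin q → Fin q → ℕ) → ℕ
  sum² f = sum λ s → sum (f s)

  private
    -- Let d = (u - w) · v and let t be the second product. For fixed v the first coordinate moves t
    -- through the whole domain, while d does not involve it and is uniform by `dot-uniform`. Hence
    -- the pair (d + t, t) is uniform.
    affine-points : ∀ {m} {u w : V m} → u ≢ w → ∀ f →
      q ℕ.* ∑V (λ v → f (dot {suc m} (1# , u) v) (dot {suc m} (1# , w) v)) ≡ q ℕ.^ m ℕ.* sum² f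
    affine-points {m} {u} {w} u≢w f = begin
      q ℕ.* ∑V (λ v → f (dot {suc m} (1# , u) v) (dot {suc m} (1# , w) v))
        ≡⟨ cong (q ℕ.*_) (trans (∑V-line λ x v → f (1# * x + dot u v) (1# * x + dot w v)) (∑-cong (V-finite m) λ v →
            trans (sum-cong-≗ λ x → relative x v) (sum-affine (λ t → f (dot (subtract u w) v + t) t) (dot w v) one≢zer))) ⟩
      q ℕ.* ∑V (λ v → sum λ t → f (dot (subtract u w) v + t) t)
        ≡⟨ dot-uniform (subtract u w) (subtract≢origin u≢w) (λ d → sum λ t → f (d + t) t) ⟩
      q ℕ.^ m ℕ.* sum (λ d → sum λ t → f (d + t) t)
        ≡⟨ cong (q ℕ.^ m ℕ.*_) (trans (∑-swap (Fin-finite q) (Fin-finite q) λ d t → f (d + t) t) (trans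
            (sum-cong-≗ λ t → sum-shift (λ s → f s t) t) (∑-swap (Fin-finite q) (Fin-finite q) λ t s → f s t))) ⟩
      q ℕ.^ m ℕ.* sum² f ∎
      where
      open ≡-Reasoning
      relative : ∀ x v → f (1# * x + dot u v) (1# * x + dot w v)
        ≡ f (dot (subtract u w) v + (1# * x + dot w v)) (1# * x + dot w v)
      relative x v = cong (λ s → f s (1# * x + dot w v)) (trans (cong (1# * x +_) (dot-subtract u w v))
        (solve 3 (λ x d e → x :+ (d :+ e) := d :+ (x :+ e)) refl (1# * x) (dot (subtract u w) v) (dot w v)))

    -- The first coordinate moves only the product with (1, u); the remaining coordinates then make
    -- the other product uniform.
    affine-infinite : ∀ {m} (u : V m) j → ∀ f →
      q ℕ.* ∑V (λ v → f (dot {suc m} (1# , u) v) (dot {suc m} (0# , vector j) v)) ≡ q ℕ.^ m ℕ.* sum² f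
    affine-infinite {m} u j f = begin
      q ℕ.* ∑V (λ v → f (dot {suc m} (1# , u) v) (dot {suc m} (0# , vector j) v))
        ≡⟨ cong (q ℕ.*_) (trans (∑V-line λ x v → f (1# * x + dot u v) (0# * x + dot (vector j) v)) (∑-cong (V-finite m) λ v →
            trans (sum-cong-≗ λ x → cong (f (1# * x + dot u v)) (vanish x (dot (vector j) v)))
              (sum-affine (λ s → f s (dot (vector j) v)) (dot u v) one≢zer))) ⟩
      q ℕ.* ∑V (λ v → sum λ s → f s (dot (vector j) v))
        ≡⟨ dot-uniform (vector j) (vector≢origin j) (λ t → sum λ s → f s t) ⟩
      q ℕ.^ m ℕ.* sum (λ t → sum λ s → f s t)
        ≡⟨ cong (q ℕ.^ m ℕ.*_) (∑-swap (Fin-finite q) (Fin-finite q) λ t s → f s t) ⟩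
      q ℕ.^ m ℕ.* sum² f ∎
      where
      open ≡-Reasoning
      vanish : ∀ x d → 0# * x + d ≡ d
      vanish x d = trans (cong (_+ d) (zeroˡ x)) (+-identityˡ d)

  -- Distinct normalised vectors are linearly independent, so their products with v take each of the
  -- q² pairs of values equally often.
  dots-uniform : ∀ {m} {i j : P m} → i ≢ j → ∀ f →
    q ℕ.* (q ℕ.* ∑V (λ v → f (dot (vector i) v) (dot (vector j) v))) ≡ q ℕ.^ m ℕ.* sum² f
  dots-uniform {suc m} {inj₁ u} {inj₁ w} i≢j f =
    trans (cong (q ℕ.*_) (affine-points (i≢j ∘ cong inj₁) f)) (sym (ℕₚ.*-assoc q (q ℕ.^ m) (sum² f)))
  dots-uniform {suc m} {inj₁ u} {inj₂ j} i≢j f =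
    trans (cong (q ℕ.*_) (affine-infinite u j f)) (sym (ℕₚ.*-assoc q (q ℕ.^ m) (sum² f)))
  dots-uniform {suc m} {inj₂ i} {inj₁ w} i≢j f =
    trans (cong (q ℕ.*_) (trans (affine-infinite w i (λ s t → f t s))
      (cong (q ℕ.^ m ℕ.*_) (∑-swap (Fin-finite q) (Fin-finite q) λ s t → f t s)))) (sym (ℕₚ.*-assoc q (q ℕ.^ m) (sum² f)))
  dots-uniform {suc m} {inj₂ i} {inj₂ j} i≢j f = begin
    q ℕ.* (q ℕ.* ∑V (λ v → f (dot {suc m} (0# , vector i) v) (dot {suc m} (0# , vector j) v)))
      ≡⟨ cong (λ s → q ℕ.* (q ℕ.* s)) (trans (∑V-line λ x v → f (0# * x + dot (vector i) v) (0# * x + dot (vector j) v)) (trans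
          (∑-cong (V-finite m) λ v → trans (sum-cong-≗ λ x → cong₂ f (vanish x (dot (vector i) v)) (vanish x (dot (vector j) v))) (sum-const q (f (dot (vector i) v) (dot (vector j) v))))
          (∑-* (V-finite m) q (λ v → f (dot (vector i) v) (dot (vector j) v))))) ⟩
    q ℕ.* (q ℕ.* (q ℕ.* ∑V (λ v → f (dot (vector i) v) (dot (vector j) v))))
      ≡⟨ cong (q ℕ.*_) (dots-uniform (i≢j ∘ cong inj₂) f) ⟩
    q ℕ.* (q ℕ.^ m ℕ.* sum² f)
      ≡⟨ ℕₚ.*-assoc q (q ℕ.^ m) (sum² f) ⟨
    q ℕ.^ suc m ℕ.* sum² f ∎
    where
    open ≡-Reasoning
    vanish : ∀ x d → 0# * x + d ≡ d
    vanish x d = trans (cong (_+ d) (zeroˡ x)) (+-identityˡ d)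

  -- A function of whether the product vanishes is constant along each line without the origin, so
  -- `∑V-lines` turns the count over vectors into one over directions; the origin leaves the summand
  -- `a`.
  dot-count : ∀ {m} {w : V (suc m)} → w ≢ origin → ∀ (f : Fin q → ℕ) {a b} → f 0# ≡ a → (∀ x → x ≢ 0# → f x ≡ b) →
    a ℕ.+ r ℕ.* ∑P (λ j → f (dot w (vector j))) ≡ q ℕ.^ m ℕ.* (a ℕ.+ r ℕ.* b)
  dot-count {m} {w} w≢0 f {a} {b} refl fx≡b = ℕₚ.*-cancelˡ-≡ _ _ q (begin
    q ℕ.* (f 0# ℕ.+ r ℕ.* ∑P (λ j → f (dot w (vector j))))
      ≡⟨ cong (λ z → q ℕ.* (f z ℕ.+ r ℕ.* ∑P (λ j → f (dot w (vector j))))) (dot-origin w) ⟨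
    q ℕ.* (f (dot w origin) ℕ.+ r ℕ.* ∑P (λ j → f (dot w (vector j))))
      ≡⟨ cong (q ℕ.*_) (∑V-lines (f ∘ dot w) invariant) ⟨
    q ℕ.* ∑V (f ∘ dot w)
      ≡⟨ dot-uniform w w≢0 f ⟩
    q ℕ.^ suc m ℕ.* sum f
      ≡⟨ trans (cong (q ℕ.^ suc m ℕ.*_) (sum-except f 0# b fx≡b)) (ℕₚ.*-assoc q (q ℕ.^ m) (f 0# ℕ.+ r ℕ.* b)) ⟩
    q ℕ.* (q ℕ.^ m ℕ.* (f 0# ℕ.+ r ℕ.* b)) ∎)
    where
    open ≡-Reasoning
    invariant : ∀ {c} v → c ≢ 0# → f (dot w (scale c v)) ≡ f (dot w v)
    invariant {c} v c≢0 with dot w v ≟ 0#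
    ... | yes d≡0 = cong f (trans (dot-scale c w v) (trans (cong (c *_) d≡0) (trans (zeroʳ c) (sym d≡0))))
    ... | no  d≢0 = trans (cong f (dot-scale c w v)) (trans (fx≡b _ (*-nonzero c≢0 d≢0)) (sym (fx≡b _ d≢0)))

  -- The same passage to directions for two rows: rescaling the column vector scales both products
  -- at once, so only simultaneous scaling has to leave `f` unchanged.
  dots-count : ∀ {m} {i j : P (suc m)} → i ≢ j → ∀ (f : Fin q → Fin q → ℕ) → (∀ {c} s t → c ≢ 0# → f (c * s) (c * t) ≡ f s t) →
    q ℕ.* (f 0# 0# ℕ.+ r ℕ.* ∑P (λ k → f (dot (vector i) (vector k)) (dot (vector j) (vector k)))) ≡ q ℕ.^ m ℕ.* sum² f
  dots-count {m} {i} {j} i≢j f inv = ℕₚ.*-cancelˡ-≡ _ _ q (begin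
    q ℕ.* (q ℕ.* (f 0# 0# ℕ.+ r ℕ.* ∑P (g ∘ vector)))
      ≡⟨ cong₂ (λ y z → q ℕ.* (q ℕ.* (f y z ℕ.+ r ℕ.* ∑P (g ∘ vector)))) (dot-origin (vector i)) (dot-origin (vector j)) ⟨
    q ℕ.* (q ℕ.* (g origin ℕ.+ r ℕ.* ∑P (g ∘ vector)))
      ≡⟨ cong (λ s → q ℕ.* (q ℕ.* s)) (∑V-lines g invariant) ⟨
    q ℕ.* (q ℕ.* ∑V g)
      ≡⟨ dots-uniform i≢j f ⟩
    q ℕ.^ suc m ℕ.* sum² f
      ≡⟨ ℕₚ.*-assoc q (q ℕ.^ m) (sum² f) ⟩
    q ℕ.* (q ℕ.^ m ℕ.* sum² f) ∎)
    where
    open ≡-Reasoning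
    g : V (suc m) → ℕ
    g v = f (dot (vector i) v) (dot (vector j) v)
    invariant : ∀ {c} v → c ≢ 0# → g (scale c v) ≡ g v
    invariant {c} v c≢0 = trans (cong₂ f (dot-scale c (vector i) v) (dot-scale c (vector j) v)) (inv _ _ c≢0)

  P-size : ∀ m → suc (r ℕ.* size (P-finite m)) ≡ q ℕ.^ m
  P-size m = trans (cong (λ s → suc (r ℕ.* s)) (sym (trans (∑-const (P-finite m) 1) (ℕₚ.*-identityʳ _)))) (trans
    (sym (∑V-lines {m} (λ _ → 1) (λ _ _ → refl))) (trans (∑-const (V-finite m) 1) (trans (ℕₚ.*-identityʳ _) (V-size m))))

-- Incidence matrices and the balanced matrix of signs

⟦_⟧ : Bool → ℕ
⟦ true  ⟧ = 1
⟦ false ⟧ = 0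

-- The points are marked by `X` inside `Fin n`, since a residual design keeps the numbering of its
-- ambient set.
record IsIncidence {n b} (X : Fin n → Bool) (I : Fin n → Fin b → Bool) (v r k lam : ℕ) : Set where
  field
    point-count    : sum (λ x → ⟦ X x ⟧) ≡ v
    incident⇒point : ∀ {x c} → I x c ≡ true → X x ≡ true
    block-size     : ∀ c → sum (λ x → ⟦ I x c ⟧) ≡ k
    replication    : ∀ {x} → X x ≡ true → sum (λ c → ⟦ I x c ⟧) ≡ r
    balance        : ∀ {x y} → X x ≡ true → X y ≡ true → x ≢ y → sum (λ c → ⟦ I x c ∧ I y c ⟧) ≡ lam

module Sign {r : ℕ} (F : FiniteDomain (suc r)) (h : ℕ) (r≡2h : r ≡ 2 ℕ.* h) where
  open Domain F
  open Character F h r≡2h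
  open CommutativeRing (domainRing F) using (zeroʳ)

  mark : Bool → ∀ {A : Set} → Dec A → Maybe Bool
  mark b (yes _) = nothing
  mark b (no _)  = just b

  -- The entries 0, +1 and -1 of the weighing matrix are `nothing`, `just false` and `just true`.
  σ : Fin q → Maybe Bool
  σ x = mark (χ x) (x ≟ 0#)

  σ-zero : σ 0# ≡ nothing
  σ-zero = go (0# ≟ 0#)
    where
    go : ∀ d → mark (χ 0#) {0# ≡ 0#} d ≡ nothing
    go (yes _)  = refl
    go (no 0≢0) = ⊥-elim (0≢0 refl)

  σ-nonzero : ∀ {x} → x ≢ 0# → σ x ≡ just (χ x)
  σ-nonzero {x} x≢0 = go (x ≟ 0#)
    where
    go : ∀ d → mark (χ x) {x ≡ 0#} d ≡ just (χ x)
    go (yes x≡0) = ⊥-elim (x≢0 x≡0)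
    go (no _)    = refl

  σ-* : ∀ {c} → c ≢ 0# → ∀ x → σ (c * x) ≡ Maybe.map (χ c xor_) (σ x)
  σ-* {c} c≢0 x = go (x ≟ 0#)
    where
    go : Dec (x ≡ 0#) → σ (c * x) ≡ Maybe.map (χ c xor_) (σ x)
    go (yes refl) = trans (cong σ (zeroʳ c)) (trans σ-zero (sym (cong (Maybe.map (χ c xor_)) σ-zero)))
    go (no x≢0)   = trans (σ-nonzero (*-nonzero c≢0 x≢0)) (trans (cong just (χ-* c≢0 x≢0))
      (sym (cong (Maybe.map (χ c xor_)) (σ-nonzero x≢0))))

  -- Multiplication by the nonsquare n₀ exchanges the two signs.
  sum-σ : ∀ (k : Maybe Bool → ℕ) {c} → k nothing ≡ 0 → k (just true) ℕ.+ k (just false) ≡ c →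
    sum (k ∘ σ) ≡ h ℕ.* c
  sum-σ k {c} k0 kc = ℕₚ.*-cancelˡ-≡ _ _ 2 (begin
    2 ℕ.* sum (k ∘ σ)
      ≡⟨ cong (sum (k ∘ σ) ℕ.+_) (ℕₚ.+-identityʳ _) ⟩
    sum (k ∘ σ) ℕ.+ sum (k ∘ σ)
      ≡⟨ cong (sum (k ∘ σ) ℕ.+_) (sum-scale (k ∘ σ) n₀≢0) ⟨
    sum (k ∘ σ) ℕ.+ sum (λ x → k (σ (n₀ * x)))
      ≡⟨ ∑-distrib-+ (k ∘ σ) (λ x → k (σ (n₀ * x))) ⟨
    sum (λ x → k (σ x) ℕ.+ k (σ (n₀ * x)))
      ≡⟨ sum-except _ 0# c nonzero ⟩
    k (σ 0#) ℕ.+ k (σ (n₀ * 0#)) ℕ.+ r ℕ.* c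
      ≡⟨ cong₂ (λ a b → a ℕ.+ b ℕ.+ r ℕ.* c) (trans (cong k σ-zero) k0) (trans (cong (k ∘ σ) (zeroʳ n₀)) (trans (cong k σ-zero) k0)) ⟩
    r ℕ.* c
      ≡⟨ trans (cong (ℕ._* c) r≡2h) (ℕₚ.*-assoc 2 h c) ⟩
    2 ℕ.* (h ℕ.* c) ∎)
    where
    open ≡-Reasoning
    both : ∀ b → k (just b) ℕ.+ k (just (not b)) ≡ c
    both true  = kc
    both false = trans (ℕₚ.+-comm (k (just false)) _) kc
    nonzero : ∀ x → x ≢ 0# → k (σ x) ℕ.+ k (σ (n₀ * x)) ≡ c
    nonzero x x≢0 = trans (cong₂ (λ a b → k a ℕ.+ k b) (σ-nonzero x≢0)
      (trans (σ-* n₀≢0 x) (cong₂ (λ b s → Maybe.map (b xor_) s) χ-n₀ (σ-nonzero x≢0)))) (both (χ x))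

  open Geometry F

  module _ .{{_ : NonZero r}} where
    -- A row has q^m nonzero entries, the points off a hyperplane, and each contributes `c`.
    σ-count : ∀ {m} {w : V (suc m)} → w ≢ origin → ∀ k {c} → k nothing ≡ 0 → (∀ b → k (just b) ≡ c) →
      ∑P (λ j → k (σ (dot w (vector j)))) ≡ q ℕ.^ m ℕ.* c
    σ-count {m} {w} w≢0 k {c} k0 kc = ℕₚ.*-cancelˡ-≡ _ _ r (trans
      (dot-count w≢0 (k ∘ σ) (trans (cong k σ-zero) k0) (λ x x≢0 → trans (cong k (σ-nonzero x≢0)) (kc (χ x))))
      (solve 3 (λ a b c → a :* (b :* c) := b :* (a :* c)) refl (q ℕ.^ m) r c))
      where open +-*-Solver using (solve; _:=_; _:*_)

    -- Balance of the weighing matrix. Scaling a column multiplies both signs by the same factor,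
    -- which `k` ignores. Over all pairs of field elements, each of the r nonzero rows sums to hq by
    -- `sum-σ`; dividing r h q · q^m by q r leaves q^m h.
    σσ-count : ∀ {m} {i j : P (suc m)} → i ≢ j → ∀ (k : Maybe Bool → Maybe Bool → ℕ) →
      (∀ s → k nothing s ≡ 0) → (∀ s → k s nothing ≡ 0) →
      (∀ e a b → k (just (e xor a)) (just (e xor b)) ≡ k (just a) (just b)) →
      (∀ a → k (just a) (just true) ℕ.+ k (just a) (just false) ≡ q) →
      ∑P (λ l → k (σ (dot (vector i) (vector l))) (σ (dot (vector j) (vector l)))) ≡ q ℕ.^ m ℕ.* h
    σσ-count {m} {i} {j} i≢j k k0ˡ k0ʳ kxor kq = ℕₚ.*-cancelˡ-≡ _ _ r (ℕₚ.*-cancelˡ-≡ _ _ q (begin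
      q ℕ.* (r ℕ.* total)
        ≡⟨ cong (λ z → q ℕ.* (z ℕ.+ r ℕ.* total)) (trans (cong₂ k σ-zero σ-zero) (k0ˡ nothing)) ⟨
      q ℕ.* (k (σ 0#) (σ 0#) ℕ.+ r ℕ.* total)
        ≡⟨ dots-count i≢j (λ s t → k (σ s) (σ t)) invariant ⟩
      q ℕ.^ m ℕ.* sum² (λ s t → k (σ s) (σ t))
        ≡⟨ cong (q ℕ.^ m ℕ.*_) (trans (sum-except _ 0# (h ℕ.* q) row) (cong (ℕ._+ r ℕ.* (h ℕ.* q)) zero-row)) ⟩
      q ℕ.^ m ℕ.* (r ℕ.* (h ℕ.* q))
        ≡⟨ solve 4 (λ a r h q → a :* (r :* (h :* q)) := q :* (r :* (a :* h))) refl (q ℕ.^ m) r h q ⟩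
      q ℕ.* (r ℕ.* (q ℕ.^ m ℕ.* h)) ∎))
      where
      open ≡-Reasoning
      open +-*-Solver using (solve; _:=_; _:*_)
      total = ∑P (λ l → k (σ (dot (vector i) (vector l))) (σ (dot (vector j) (vector l))))
      map-invariant : ∀ e a b → k (Maybe.map (e xor_) a) (Maybe.map (e xor_) b) ≡ k a b
      map-invariant e nothing  b        = trans (k0ˡ _) (sym (k0ˡ b))
      map-invariant e (just a) nothing  = trans (k0ʳ _) (sym (k0ʳ (just a)))
      map-invariant e (just a) (just b) = kxor e a b
      invariant : ∀ {c} s t → c ≢ 0# → k (σ (c * s)) (σ (c * t)) ≡ k (σ s) (σ t)
      invariant {c} s t c≢0 = trans (cong₂ k (σ-* c≢0 s) (σ-* c≢0 t)) (map-invariant (χ c) (σ s) (σ t))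
      zero-row : sum (λ t → k (σ 0#) (σ t)) ≡ 0
      zero-row = trans (sum-cong-≗ λ t → trans (cong (λ s → k s (σ t)) σ-zero) (k0ˡ (σ t))) (trans (sum-const q 0) (ℕₚ.*-zeroʳ q))
      row : ∀ s → s ≢ 0# → sum (λ t → k (σ s) (σ t)) ≡ h ℕ.* q
      row s s≢0 = sum-σ (k (σ s)) (k0ʳ (σ s))
        (trans (cong (λ a → k a (just true) ℕ.+ k a (just false)) (σ-nonzero s≢0)) (kq (χ s)))

⟦⟧-split : ∀ a b → ⟦ a ∧ not b ⟧ ℕ.+ ⟦ a ∧ b ⟧ ≡ ⟦ a ⟧
⟦⟧-split true  true  = refl
⟦⟧-split true  false = refl
⟦⟧-split false b     = refl

-- The complement is taken among the actual points only, hence the mask by x.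
place : Maybe Bool → Bool → Bool → Bool
place nothing      x n = false
place (just false) x n = n
place (just true)  x n = x ∧ not n

-- The points of the new design are (i , x) with i ∈ P and x a residual point, and
-- the vectors of V.  One block is V; the block (j , c) meets {i} × R in the residual
-- block c, in its complement or not at all, according to the sign of i · j, and
-- contains y ∈ V if the derived point numbered y · j lies in block c.
module Construction {h′ : ℕ} (F : FiniteDomain (suc (2 ℕ.* suc h′))) (m : ℕ)
  {n b : ℕ} (b≡2q : b ≡ 2 ℕ.* suc (2 ℕ.* suc h′))
  {X : Fin n → Bool} {N : Fin n → Fin b → Bool}
  (isN : IsIncidence X N (2 ℕ.+ 2 ℕ.* suc h′) (suc (2 ℕ.* suc h′)) (2 ℕ.+ h′) (suc h′))
  {D : Fin (suc (2 ℕ.* suc h′)) → Fin b → Bool}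
  (isD : IsIncidence (λ _ → true) D (suc (2 ℕ.* suc h′)) (2 ℕ.* suc h′) (suc h′) h′)
  (mixed : ∀ {x} → X x ≡ true → ∀ s → sum (λ c → ⟦ N x c ∧ D s c ⟧) ≡ suc h′)
  where
  private
    h r q : ℕ
    h = suc h′
    r = 2 ℕ.* h
    q = suc r

  open Domain F using (0#; _+_)
  open Character F h refl
  open Sign F h refl
  open Geometry F
  open CommutativeRing (domainRing F) using (*-comm; +-identityˡ)
  open RingProperties (CommutativeRing.ring (domainRing F)) using (+-cancelʳ)
  private
    module NI = IsIncidence isN
    module DI = IsIncidence isD

  Point Block : Set
  Point = (P (suc m) × Fin n) ⊎ V (suc m)
  Block = ⊤ ⊎ (P (suc m) × Fin b)

  Point-finite : Finite Point
  Point-finite = (P-finite (suc m) ×-finite Fin-finite n) ⊎-finite V-finite (suc m)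

  Block-finite : Finite Block
  Block-finite = ⊤-finite ⊎-finite (P-finite (suc m) ×-finite Fin-finite b)

  valid : Point → Bool
  valid (inj₁ (i , x)) = X x
  valid (inj₂ y)       = true

  sign : P (suc m) → P (suc m) → Maybe Bool
  sign i j = σ (dot (vector i) (vector j))

  inc : Point → Block → Bool
  inc (inj₁ _)       (inj₁ _)       = false
  inc (inj₂ _)       (inj₁ _)       = true
  inc (inj₁ (i , x)) (inj₂ (j , c)) = place (sign i j) (X x) (N x c)
  inc (inj₂ y)       (inj₂ (j , c)) = D (dot y (vector j)) c

  ∑-Point : ∀ f → ∑ Point-finite f ≡ ∑P (λ i → sum λ x → f (inj₁ (i , x))) ℕ.+ ∑V (λ y → f (inj₂ y))
  ∑-Point f = trans (∑-⊎ (P-finite (suc m) ×-finite Fin-finite n) (V-finite (suc m)) f)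
    (cong (ℕ._+ ∑V (λ y → f (inj₂ y))) (∑-× (P-finite (suc m)) (Fin-finite n) (f ∘ inj₁)))

  ∑-Block : ∀ f → ∑ Block-finite f ≡ f (inj₁ tt) ℕ.+ ∑P (λ j → sum λ c → f (inj₂ (j , c)))
  ∑-Block f = trans (∑-⊎ ⊤-finite (P-finite (suc m) ×-finite Fin-finite b) f)
    (cong₂ ℕ._+_ (ℕₚ.+-identityʳ (f (inj₁ tt))) (∑-× (P-finite (suc m)) (Fin-finite b) (f ∘ inj₂)))

  dot-comm : ∀ {m} (v w : V m) → dot v w ≡ dot w v
  dot-comm {zero}  v       w       = refl
  dot-comm {suc m} (x , v) (y , w) = cong₂ _+_ (*-comm x y) (dot-comm v w)

  private
    q≡2h+1 : suc h ℕ.+ h ≡ q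
    q≡2h+1 = cong suc (cong (h ℕ.+_) (sym (ℕₚ.+-identityʳ h)))

    -- A point of R lies in q of the 2q blocks, so it lies in equally many complements.
    place-row : ∀ {x} → X x ≡ true → ∀ a → sum (λ c → ⟦ place (just a) (X x) (N x c) ⟧) ≡ q
    place-row Xx false = NI.replication Xx
    place-row {x} Xx true = ℕₚ.+-cancelʳ-≡ _ _ _ (begin
      sum (λ c → ⟦ X x ∧ not (N x c) ⟧) ℕ.+ q
        ≡⟨ cong (sum (λ c → ⟦ X x ∧ not (N x c) ⟧) ℕ.+_) (trans (sym (NI.replication Xx))
             (sum-cong-≗ λ c → cong (λ a → ⟦ a ∧ N x c ⟧) (sym Xx))) ⟩
      sum (λ c → ⟦ X x ∧ not (N x c) ⟧) ℕ.+ sum (λ c → ⟦ X x ∧ N x c ⟧)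
        ≡⟨ ∑-distrib-+ (λ c → ⟦ X x ∧ not (N x c) ⟧) (λ c → ⟦ X x ∧ N x c ⟧) ⟨
      sum (λ c → ⟦ X x ∧ not (N x c) ⟧ ℕ.+ ⟦ X x ∧ N x c ⟧)
        ≡⟨ sum-cong-≗ (λ c → trans (⟦⟧-split (X x) (N x c)) (cong ⟦_⟧ Xx)) ⟩
      sum {b} (λ _ → 1)
        ≡⟨ trans (sum-const b 1) (trans (ℕₚ.*-identityʳ b) b≡2q) ⟩
      2 ℕ.* q
        ≡⟨ cong (q ℕ.+_) (ℕₚ.+-identityʳ q) ⟩
      q ℕ.+ q ∎)
      where open ≡-Reasoning

    -- A block of R has h + 1 of the 2h + 2 points, so its complement has the same size.
    place-column : ∀ a c → sum (λ x → ⟦ place (just a) (X x) (N x c) ⟧) ≡ suc h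
    place-column false c = NI.block-size c
    place-column true  c = ℕₚ.+-cancelʳ-≡ (suc h) _ _ (begin
      sum (λ x → ⟦ X x ∧ not (N x c) ⟧) ℕ.+ suc h
        ≡⟨ cong (sum (λ x → ⟦ X x ∧ not (N x c) ⟧) ℕ.+_) (sym (trans (sum-cong-≗ (λ x → cong ⟦_⟧ (absorb x))) (NI.block-size c))) ⟩
      sum (λ x → ⟦ X x ∧ not (N x c) ⟧) ℕ.+ sum (λ x → ⟦ X x ∧ N x c ⟧)
        ≡⟨ ∑-distrib-+ (λ x → ⟦ X x ∧ not (N x c) ⟧) (λ x → ⟦ X x ∧ N x c ⟧) ⟨
      sum (λ x → ⟦ X x ∧ not (N x c) ⟧ ℕ.+ ⟦ X x ∧ N x c ⟧)
        ≡⟨ trans (sum-cong-≗ (λ x → ⟦⟧-split (X x) (N x c))) NI.point-count ⟩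
      suc q
        ≡⟨ cong suc (trans (sym q≡2h+1) (sym (ℕₚ.+-suc h h))) ⟩
      suc h ℕ.+ suc h ∎)
      where
      open ≡-Reasoning
      absorb : ∀ x → X x ∧ N x c ≡ N x c
      absorb x with N x c in eq
      ... | true  = cong (_∧ true) (NI.incident⇒point eq)
      ... | false with X x
      ...   | true  = refl
      ...   | false = refl

    meet : (x y : Fin n) → Maybe Bool → Maybe Bool → ℕ
    meet x y s t = sum λ c → ⟦ place s (X x) (N x c) ∧ place t (X y) (N y c) ⟧

    meet-nothingˡ : ∀ x y t → meet x y nothing t ≡ 0
    meet-nothingˡ x y t = trans (sum-const b 0) (ℕₚ.*-zeroʳ b)

    meet-nothingʳ : ∀ x y s → meet x y s nothing ≡ 0
    meet-nothingʳ x y s = trans (sum-cong-≗ λ c → cong ⟦_⟧ (∧-zeroʳ (place s (X x) (N x c)))) (meet-nothingˡ x y s)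

    meet-comm : ∀ x y s t → meet x y s t ≡ meet y x t s
    meet-comm x y s t = sum-cong-≗ λ c → cong ⟦_⟧ (∧-comm (place s (X x) (N x c)) (place t (X y) (N y c)))

    meet-row : ∀ {x y} → X x ≡ true → X y ≡ true → ∀ a → meet x y (just a) (just true) ℕ.+ meet x y (just a) (just false) ≡ q
    meet-row {x} {y} Xx Xy a = trans (sym (∑-distrib-+ {b} (λ c → ⟦ place (just a) (X x) (N x c) ∧ (X y ∧ not (N y c)) ⟧) (λ c → ⟦ place (just a) (X x) (N x c) ∧ N y c ⟧)))
      (trans (sum-cong-≗ λ c → complement (place (just a) (X x) (N x c)) (N y c))
      (place-row Xx a))
      where
      complement : ∀ s n → ⟦ s ∧ (X y ∧ not n) ⟧ ℕ.+ ⟦ s ∧ n ⟧ ≡ ⟦ s ⟧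
      complement s n rewrite Xy = ⟦⟧-split s n

    meet-column : ∀ {x y} → X x ≡ true → X y ≡ true → ∀ a → meet x y (just true) (just a) ℕ.+ meet x y (just false) (just a) ≡ q
    meet-column {x} {y} Xx Xy a = trans (cong₂ ℕ._+_ (meet-comm x y (just true) (just a)) (meet-comm x y (just false) (just a))) (meet-row Xy Xx a)

    -- In a 2 by 2 table whose rows and columns all sum to q, diagonally opposite entries are equal.
    meet-xor : ∀ {x y} → X x ≡ true → X y ≡ true → ∀ e a b →
      meet x y (just (e xor a)) (just (e xor b)) ≡ meet x y (just a) (just b)
    meet-xor Xx Xy false a b = refl
    meet-xor {x} {y} Xx Xy true  a b = flip a b
      where
      both : meet x y (just true) (just true) ≡ meet x y (just false) (just false)
      both = ℕₚ.+-cancelʳ-≡ (meet x y (just true) (just false)) _ _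
        (trans (meet-row Xx Xy true) (sym (trans (ℕₚ.+-comm (meet x y (just false) (just false)) _) (meet-column Xx Xy false))))
      cross : meet x y (just true) (just false) ≡ meet x y (just false) (just true)
      cross = ℕₚ.+-cancelʳ-≡ (meet x y (just false) (just false)) _ _
        (trans (meet-column Xx Xy false) (sym (meet-row Xx Xy false)))
      flip : ∀ a b → meet x y (just (not a)) (just (not b)) ≡ meet x y (just a) (just b)
      flip true  true  = sym both
      flip false false = both
      flip true  false = sym cross
      flip false true  = cross

    -- The derived point `s` lies in 2h blocks; h of them have residual parts containing x, so the
    -- other h have complements containing it.
    meet-derived : ∀ {x} → X x ≡ true → ∀ a s → sum (λ c → ⟦ place (just a) (X x) (N x c) ∧ D s c ⟧) ≡ h
    meet-derived Xx false s = mixed Xx s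
    meet-derived {x} Xx true s = ℕₚ.+-cancelʳ-≡ h _ _ (begin
      sum (λ c → ⟦ (X x ∧ not (N x c)) ∧ D s c ⟧) ℕ.+ h
        ≡⟨ cong (sum (λ c → ⟦ (X x ∧ not (N x c)) ∧ D s c ⟧) ℕ.+_) (mixed Xx s) ⟨
      sum (λ c → ⟦ (X x ∧ not (N x c)) ∧ D s c ⟧) ℕ.+ sum (λ c → ⟦ N x c ∧ D s c ⟧)
        ≡⟨ ∑-distrib-+ (λ c → ⟦ (X x ∧ not (N x c)) ∧ D s c ⟧) (λ c → ⟦ N x c ∧ D s c ⟧) ⟨
      sum (λ c → ⟦ (X x ∧ not (N x c)) ∧ D s c ⟧ ℕ.+ ⟦ N x c ∧ D s c ⟧)
        ≡⟨ trans (sum-cong-≗ λ c → complement (N x c) (D s c)) (DI.replication refl) ⟩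
      h ℕ.+ (h ℕ.+ 0)
        ≡⟨ cong (h ℕ.+_) (ℕₚ.+-identityʳ h) ⟩
      h ℕ.+ h ∎)
      where
      open ≡-Reasoning
      complement : ∀ n d → ⟦ (X x ∧ not n) ∧ d ⟧ ℕ.+ ⟦ n ∧ d ⟧ ≡ ⟦ d ⟧
      complement n d rewrite Xx with n | d
      ... | true  | true  = refl
      ... | true  | false = refl
      ... | false | true  = refl
      ... | false | false = refl

  -- There are q + 1 residual points for each element of P, and the q^(m+1) vectors number 1 + r |P|
  -- by `P-size`.
  size-Point : ∑ Point-finite (⟦_⟧ ∘ valid) ≡ 2 ℕ.* q ℕ.* size (P-finite (suc m)) ℕ.+ 1
  size-Point = begin
    ∑ Point-finite (⟦_⟧ ∘ valid)
      ≡⟨ ∑-Point (⟦_⟧ ∘ valid) ⟩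
    ∑P {suc m} (λ i → sum λ x → ⟦ X x ⟧) ℕ.+ ∑V {suc m} (λ y → 1)
      ≡⟨ cong₂ ℕ._+_ (trans (∑-cong (P-finite (suc m)) λ _ → NI.point-count) (∑-const (P-finite (suc m)) (suc q)))
           (trans (∑-const (V-finite (suc m)) 1) (trans (ℕₚ.*-identityʳ _) (trans (V-size (suc m)) (sym (P-size (suc m)))))) ⟩
    size (P-finite (suc m)) ℕ.* suc q ℕ.+ suc (r ℕ.* size (P-finite (suc m)))
      ≡⟨ solve 2 (λ p r → p :* (con 2 :+ r) :+ (con 1 :+ r :* p) := con 2 :* (con 1 :+ r) :* p :+ con 1) refl (size (P-finite (suc m))) r ⟩
    2 ℕ.* q ℕ.* size (P-finite (suc m)) ℕ.+ 1 ∎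
    where
    open ≡-Reasoning
    open +-*-Solver using (solve; con; _:=_; _:+_; _:*_)

  size-Block : size Block-finite ≡ 2 ℕ.* q ℕ.* size (P-finite (suc m)) ℕ.+ 1
  size-Block = trans (cong suc (trans (ℕₚ.*-comm (size (P-finite (suc m))) b) (cong (ℕ._* size (P-finite (suc m))) b≡2q)))
    (ℕₚ.+-comm 1 _)

  block-size : ∀ B → ∑ Point-finite (λ x → ⟦ inc x B ⟧) ≡ q ℕ.^ suc m
  block-size (inj₁ tt) = trans (∑-Point λ x → ⟦ inc x (inj₁ tt) ⟧) (cong₂ ℕ._+_
    (trans (∑-cong (P-finite (suc m)) λ _ → trans (sum-const n 0) (ℕₚ.*-zeroʳ n))
      (trans (∑-const (P-finite (suc m)) 0) (ℕₚ.*-zeroʳ (size (P-finite (suc m))))))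
    (trans (∑-const (V-finite (suc m)) 1) (trans (ℕₚ.*-identityʳ _) (V-size (suc m)))))
  block-size (inj₂ (j , c)) = begin
    ∑ Point-finite (λ x → ⟦ inc x (inj₂ (j , c)) ⟧)
      ≡⟨ ∑-Point (λ x → ⟦ inc x (inj₂ (j , c)) ⟧) ⟩
    ∑P (λ i → column (sign i j)) ℕ.+ ∑V (λ y → ⟦ D (dot y (vector j)) c ⟧)
      ≡⟨ cong₂ ℕ._+_ (trans (∑-cong (P-finite (suc m)) λ i → cong (column ∘ σ) (dot-comm (vector i) (vector j)))
             (σ-count (vector≢origin j) column (trans (sum-const n 0) (ℕₚ.*-zeroʳ n)) (λ a → place-column a c)))
           (trans (∑-cong (V-finite (suc m)) λ y → cong (λ s → ⟦ D s c ⟧) (dot-comm y (vector j))) derived-part) ⟩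
    -- The residual part has h + 1 points for each of q^m nonzero signs, the derived part h
    -- hyperplanes of q^m vectors.
    q ℕ.^ m ℕ.* suc h ℕ.+ q ℕ.^ m ℕ.* h
      ≡⟨ trans (sym (ℕₚ.*-distribˡ-+ (q ℕ.^ m) (suc h) h)) (trans (cong (q ℕ.^ m ℕ.*_) q≡2h+1) (ℕₚ.*-comm (q ℕ.^ m) q)) ⟩
    q ℕ.^ suc m ∎
    where
    open ≡-Reasoning
    column : Maybe Bool → ℕ
    column s = sum λ x → ⟦ place s (X x) (N x c) ⟧
    derived-part : ∑V (λ y → ⟦ D (dot (vector j) y) c ⟧) ≡ q ℕ.^ m ℕ.* h
    derived-part = ℕₚ.*-cancelˡ-≡ _ _ q (trans (dot-uniform (vector j) (vector≢origin j) (λ s → ⟦ D s c ⟧))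
      (trans (cong (q ℕ.^ suc m ℕ.*_) (DI.block-size c)) (ℕₚ.*-assoc q (q ℕ.^ m) h)))

  replication : ∀ x → valid x ≡ true → ∑ Block-finite (λ B → ⟦ inc x B ⟧) ≡ q ℕ.^ suc m
  replication (inj₁ (i , x)) Xx = trans (∑-Block (λ B → ⟦ inc (inj₁ (i , x)) B ⟧))
    (trans (σ-count (vector≢origin i) (λ s → sum λ c → ⟦ place s (X x) (N x c) ⟧) (trans (sum-const b 0) (ℕₚ.*-zeroʳ b)) (place-row Xx))
      (ℕₚ.*-comm (q ℕ.^ m) q))
  replication (inj₂ y) _ = trans (∑-Block (λ B → ⟦ inc (inj₂ y) B ⟧))
    (trans (cong suc (trans (∑-cong (P-finite (suc m)) λ j → DI.replication {dot y (vector j)} refl)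
      (trans (∑-const (P-finite (suc m)) r) (ℕₚ.*-comm (size (P-finite (suc m))) r)))) (P-size (suc m)))

  residual-derived : ∀ i x y → X x ≡ true →
    ∑ Block-finite (λ B → ⟦ inc (inj₁ (i , x)) B ∧ inc (inj₂ y) B ⟧) ≡ q ℕ.^ m ℕ.* h
  residual-derived i x y Xx = trans (∑-Block (λ B → ⟦ inc (inj₁ (i , x)) B ∧ inc (inj₂ y) B ⟧))
    (trans (∑-cong (P-finite (suc m)) λ j → meeting (sign i j) (dot y (vector j)))
      (σ-count (vector≢origin i) (Maybe.maybe′ (λ _ → h) 0) refl (λ _ → refl)))
    where
    meeting : ∀ s t → sum (λ c → ⟦ place s (X x) (N x c) ∧ D t c ⟧) ≡ Maybe.maybe′ (λ _ → h) 0 s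
    meeting nothing  t = trans (sum-const b 0) (ℕₚ.*-zeroʳ b)
    meeting (just a) t = meet-derived Xx a t

  balance : ∀ x y → valid x ≡ true → valid y ≡ true → x ≢ y → ∑ Block-finite (λ B → ⟦ inc x B ∧ inc y B ⟧) ≡ q ℕ.^ m ℕ.* h
  balance x@(inj₁ (i , a)) y@(inj₁ (j , a′)) Xa Xa′ x≢y = trans (∑-Block (λ B → ⟦ inc x B ∧ inc y B ⟧)) (go (P-≟ i j))
    where
    go : Dec (i ≡ j) → ∑P (λ l → meet a a′ (sign i l) (sign j l)) ≡ q ℕ.^ m ℕ.* h
    -- Within one copy of R both signs agree in every column, so each nonzero entry contributes the
    -- balance h of R or of its complement.
    go (yes refl) = σ-count (vector≢origin i) (λ s → meet a a′ s s) (meet-nothingˡ a a′ nothing) λ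
      { false → same ; true → trans (meet-xor Xa Xa′ true false false) same }
      where
      same : meet a a′ (just false) (just false) ≡ h
      same = NI.balance Xa Xa′ (λ a≡a′ → x≢y (cong (λ a → inj₁ (i , a)) a≡a′))
    go (no i≢j) = σσ-count i≢j (meet a a′) (meet-nothingˡ a a′) (meet-nothingʳ a a′) (meet-xor Xa Xa′) (meet-row Xa Xa′)
  balance (inj₁ (i , x)) (inj₂ y) Xx _ _ = residual-derived i x y Xx
  balance (inj₂ y) (inj₁ (i , x)) _ Xx _ =
    trans (∑-cong Block-finite λ B → cong ⟦_⟧ (∧-comm (inc (inj₂ y) B) (inc (inj₁ (i , x)) B))) (residual-derived i x y Xx)
  -- Directions orthogonal to y - z give r common blocks, all others h′. After multiplying by r, the
  -- `suc` from the block V becomes the summand r that `dot-count` wants for the origin.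
  balance (inj₂ y) (inj₂ z) _ _ y≢z = trans (∑-Block (λ B → ⟦ inc (inj₂ y) B ∧ inc (inj₂ z) B ⟧))
    (ℕₚ.*-cancelˡ-≡ _ _ r (begin
      r ℕ.* suc (∑P λ j → sum λ c → ⟦ D (dot y (vector j)) c ∧ D (dot z (vector j)) c ⟧)
        ≡⟨ cong (λ s → r ℕ.* suc s) (∑-cong (P-finite (suc m)) λ j → common j (dot (subtract y z) (vector j) ≟ 0#)) ⟩
      r ℕ.* suc (∑P λ j → agreement (dot (subtract y z) (vector j)))
        ≡⟨ ℕₚ.*-suc r _ ⟩
      r ℕ.+ r ℕ.* ∑P (λ j → agreement (dot (subtract y z) (vector j)))
        ≡⟨ dot-count (subtract≢origin (y≢z ∘ cong inj₂)) agreement (agree≡ (0# ≟ 0#) refl) (λ s → agree≢ (s ≟ 0#)) ⟩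
      q ℕ.^ m ℕ.* (r ℕ.+ r ℕ.* h′)
        ≡⟨ solve 3 (λ a r h → a :* (r :+ r :* h) := r :* (a :* (con 1 :+ h))) refl (q ℕ.^ m) r h′ ⟩
      r ℕ.* (q ℕ.^ m ℕ.* h) ∎))
    where
    open ≡-Reasoning
    open +-*-Solver using (solve; con; _:=_; _:+_; _:*_)
    agree : ∀ {s} → Dec (s ≡ 0#) → ℕ
    agree (yes _) = r
    agree (no _)  = h′
    agreement : Fin q → ℕ
    agreement s = agree (s ≟ 0#)
    agree≡ : ∀ {s} (d : Dec (s ≡ 0#)) → s ≡ 0# → agree d ≡ r
    agree≡ (yes _) _ = refl
    agree≡ (no s≢0) s≡0 = ⊥-elim (s≢0 s≡0)
    agree≢ : ∀ {s} (d : Dec (s ≡ 0#)) → s ≢ 0# → agree d ≡ h′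
    agree≢ (yes s≡0) s≢0 = ⊥-elim (s≢0 s≡0)
    agree≢ (no _) _ = refl
    common : ∀ j (d : Dec (dot (subtract y z) (vector j) ≡ 0#)) →
      sum (λ c → ⟦ D (dot y (vector j)) c ∧ D (dot z (vector j)) c ⟧) ≡ agree d
    common j (yes d≡0) = trans (sum-cong-≗ λ c → cong ⟦_⟧ (trans (cong (λ s → D s c ∧ D (dot z (vector j)) c) same) (∧-idem _)))
      (DI.replication refl)
      where
      same : dot y (vector j) ≡ dot z (vector j)
      same = trans (dot-subtract y z (vector j)) (trans (cong (_+ dot z (vector j)) d≡0) (+-identityˡ _))
    common j (no d≢0) = DI.balance refl refl λ same → d≢0 (+-cancelʳ (dot z (vector j)) _ _
      (trans (sym (dot-subtract y z (vector j))) (trans same (sym (+-identityˡ _)))))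

  isIncidence : IsIncidence (valid ∘ enum Point-finite) (λ x B → inc (enum Point-finite x) (enum Block-finite B))
    (2 ℕ.* q ℕ.* size (P-finite (suc m)) ℕ.+ 1) (q ℕ.^ suc m) (q ℕ.^ suc m) (q ℕ.^ m ℕ.* h)
  isIncidence = record
    { point-count    = size-Point
    ; incident⇒point = λ {x} {B} → inc⇒valid (enum Point-finite x) (enum Block-finite B)
    ; block-size     = λ B → block-size (enum Block-finite B)
    ; replication    = λ {x} → replication (enum Point-finite x)
    ; balance        = λ {x} {y} Xx Xy x≢y →
        balance (enum Point-finite x) (enum Point-finite y) Xx Xy (x≢y ∘ Finite.enum-injective Point-finite) }
    where
    place⇒ : ∀ s {x n} → (n ≡ true → x ≡ true) → place s x n ≡ true → x ≡ true
    place⇒ (just false) n⇒x e = n⇒x e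
    place⇒ (just true) {true} n⇒x e = refl
    inc⇒valid : ∀ x B → inc x B ≡ true → valid x ≡ true
    inc⇒valid (inj₁ (i , x)) (inj₂ (j , c)) e = place⇒ (sign i j) NI.incident⇒point e
    inc⇒valid (inj₂ y) B e = refl

-- Designs as incidence matrices

open import Data.Nat.Base using (_+_; _*_; _∸_; _^_; _/_)

does-∈? : ∀ {n} (x : Fin n) p → does (x ∈? p) ≡ lookup p x
does-∈? zero    (true  ∷ p) = refl
does-∈? zero    (false ∷ p) = refl
does-∈? (suc x) (s ∷ p)     = does-∈? x p

∣∣-sum : ∀ {n} (p : Subset n) → ∣ p ∣ ≡ sum λ x → ⟦ lookup p x ⟧
∣∣-sum []          = refl
∣∣-sum (true  ∷ p) = cong suc (∣∣-sum p)
∣∣-sum (false ∷ p) = ∣∣-sum p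

length-filter : ∀ {A : Set} {P : A → Set} (P? : ∀ a → Dec (P a)) xs →
  length (filter P? xs) ≡ sum λ i → ⟦ does (P? (List.lookup xs i)) ⟧
length-filter P? []       = refl
length-filter P? (x ∷ xs) with does (P? x)
... | true  = cong suc (length-filter P? xs)
... | false = length-filter P? xs

sum-map : ∀ {A B : Set} (f : A → B) (g : B → ℕ) xs →
  sum (λ i → g (List.lookup (List.map f xs) i)) ≡ sum λ i → g (f (List.lookup xs i))
sum-map f g []       = refl
sum-map f g (x ∷ xs) = cong (g (f x) +_) (sum-map f g xs)

sum-lookup-tabulate : ∀ {A : Set} {n} (f : Fin n → A) (g : A → ℕ) →
  sum (λ i → g (List.lookup (List.tabulate f) i)) ≡ sum (g ∘ f)
sum-lookup-tabulate {n = zero}  f g = refl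
sum-lookup-tabulate {n = suc n} f g = cong (g (f zero) +_) (sum-lookup-tabulate (f ∘ suc) g)

sum-removeAt : ∀ {A : Set} (g : A → ℕ) xs i →
  sum (λ j → g (List.lookup xs j)) ≡ g (List.lookup xs i) + sum λ j → g (List.lookup (removeAt xs i) j)
sum-removeAt g (x ∷ xs) zero    = refl
sum-removeAt g (x ∷ xs) (suc i) = trans (cong (g x +_) (sum-removeAt g xs i))
  (solve 3 (λ a b c → a :+ (b :+ c) := b :+ (a :+ c)) refl (g x) (g (List.lookup xs i)) (sum λ j → g (List.lookup (removeAt xs i) j)))
  where open +-*-Solver using (solve; _:=_; _:+_)

design : ∀ {n} → Subset n → List (Subset n) → Design
design points blocks = record { points = points ; blocks = blocks }

module _ {n v b r k lam} {points : Subset n} {xs : List (Subset n)} (f : Subset n → Subset n)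
  (isBIBD : IsBIBD (design points (List.map f xs)) v b r k lam) where
  open IsBIBD isBIBD
  private
    incidence : Fin n → Fin (length xs) → Bool
    incidence x c = lookup (f (List.lookup xs c)) x

    All-map : ∀ {A B : Set} {P : B → Set} (f : A → B) xs → All P (List.map f xs) → ∀ i → P (f (List.lookup xs i))
    All-map f (x ∷ xs) (p ∷ ps) zero    = p
    All-map f (x ∷ xs) (p ∷ ps) (suc i) = All-map f xs ps i

    count : ∀ {P : Subset n → Set} (P? : ∀ B → Dec (P B)) (g : Subset n → Bool) → (∀ B → does (P? B) ≡ g B) →
      sum (λ c → ⟦ g (f (List.lookup xs c)) ⟧) ≡ length (filter P? (List.map f xs))
    count P? g e = sym (trans (length-filter P? (List.map f xs)) (trans (sum-cong-≗ λ i → cong ⟦_⟧ (e (List.lookup (List.map f xs) i)))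
      (sum-map f (⟦_⟧ ∘ g) xs)))

  -- Columns are indexed by positions in `xs`, not in the mapped list, so that residual and derived
  -- designs share one index set and their blocks stay paired.
  BIBD⇒incidence : IsIncidence (lookup points) incidence v r k lam
  BIBD⇒incidence = record
    { point-count    = trans (sym (∣∣-sum points)) point-count
    ; incident⇒point = λ {x} {c} e → []=⇒lookup (All-map f xs blocks⊆points c (lookup⇒[]= x _ e))
    ; block-size     = λ c → trans (sym (∣∣-sum (f (List.lookup xs c)))) (All-map f xs block-size c)
    ; replication    = λ {x} p → trans (count (x ∈?_) (λ B → lookup B x) (does-∈? x)) (replication (lookup⇒[]= x points p))
    ; balance        = λ {x} {y} p q x≢y → trans
        (count (λ B → (x ∈? B) ×-dec (y ∈? B)) (λ B → lookup B x ∧ lookup B y) (λ B → cong₂ _∧_ (does-∈? x B) (does-∈? y B)))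
        (balance (lookup⇒[]= x points p) (lookup⇒[]= y points q) x≢y) }

  BIBD-block-count : length xs ≡ b
  BIBD-block-count = trans (sym (length-map f xs)) block-count

module _ {n b v r k lam} {X : Fin n → Bool} {I : Fin n → Fin b → Bool} (isIncidence : IsIncidence X I v r k lam) where
  open IsIncidence isIncidence
  private
    column : Fin b → Subset n
    column c = tabulate λ x → I x c

    count : ∀ {P : Subset n → Set} (P? : ∀ B → Dec (P B)) (g : Fin b → Bool) → (∀ c → does (P? (column c)) ≡ g c) →
      length (filter P? (List.tabulate column)) ≡ sum (⟦_⟧ ∘ g)
    count P? g e = trans (length-filter P? (List.tabulate column))
      (trans (sum-lookup-tabulate column (λ B → ⟦ does (P? B) ⟧)) (sum-cong-≗ λ c → cong ⟦_⟧ (e c)))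

    does-column : ∀ x c → does (x ∈? column c) ≡ I x c
    does-column x c = trans (does-∈? x (column c)) (lookup∘tabulate (λ x → I x c) x)

    ∈⇒X : ∀ {x} → x ∈ tabulate X → X x ≡ true
    ∈⇒X {x} x∈ = trans (sym (lookup∘tabulate X x)) ([]=⇒lookup x∈)

    ∣tabulate∣ : ∀ (g : Fin n → Bool) → ∣ tabulate g ∣ ≡ sum (⟦_⟧ ∘ g)
    ∣tabulate∣ g = trans (∣∣-sum (tabulate g)) (sum-cong-≗ λ x → cong ⟦_⟧ (lookup∘tabulate g x))

  incidence⇒design : Design
  incidence⇒design = design (tabulate X) (List.tabulate column)

  incidence⇒BIBD : IsBIBD incidence⇒design v b r k lam
  incidence⇒BIBD = record
    { blocks⊆points = tabulate⁺ λ c {x} x∈ → lookup⇒[]= x (tabulate X) (trans (lookup∘tabulate X x)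
        (incident⇒point (trans (sym (lookup∘tabulate (λ x → I x c) x)) ([]=⇒lookup x∈))))
    ; point-count = trans (∣tabulate∣ X) point-count
    ; block-count = length-tabulate column
    ; block-size = tabulate⁺ λ c → trans (∣tabulate∣ (λ x → I x c)) (block-size c)
    ; replication = λ {x} x∈ → trans (count (x ∈?_) (I x) (does-column x)) (replication (∈⇒X x∈))
    ; balance = λ {x} {y} x∈ y∈ x≢y → trans
        (count (λ B → (x ∈? B) ×-dec (y ∈? B)) (λ c → I x c ∧ I y c) (λ c → cong₂ _∧_ (does-column x c) (does-column y c)))
        (balance (∈⇒X x∈) (∈⇒X y∈) x≢y) }

-- Numbers the points of the removed block by field elements; `sum-element` turns sums over numbers
-- into sums over the ambient set.
record Enumeration {n} (p : Subset n) (k : ℕ) : Set where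
  field
    element   : Fin k → Fin n
    injective : ∀ {i j} → element i ≡ element j → i ≡ j
    member    : ∀ i → lookup p (element i) ≡ true
    sum-element : ∀ (g : Fin n → ℕ) → sum (g ∘ element) ≡ sum λ x → if lookup p x then g x else 0

enumerate : ∀ {n} (p : Subset n) → Enumeration p ∣ p ∣
enumerate [] = record { element = λ () ; injective = λ { {()} } ; member = λ () ; sum-element = λ _ → refl }
enumerate (false ∷ p) = record
  { element = suc ∘ element ; injective = λ { {i} {j} e → injective (suc-injective e) } ; member = member
  ; sum-element = λ g → sum-element (g ∘ suc) }
  where
  open Enumeration (enumerate p)
enumerate {suc n} (true ∷ p) = record
  { element = element′ ; injective = λ {i} {j} → injective′ i j ; member = λ { zero → refl ; (suc i) → member i }
  ; sum-element = λ g → cong (g zero +_) (sum-element (g ∘ suc)) }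
  where
  open Enumeration (enumerate p)
  element′ : Fin (suc ∣ p ∣) → Fin (suc n)
  element′ zero    = zero
  element′ (suc i) = suc (element i)
  injective′ : ∀ i j → element′ i ≡ element′ j → i ≡ j
  injective′ zero    zero    e = refl
  injective′ (suc i) (suc j) e = cong suc (injective (suc-injective e))

module _ {n v b′ r′ k lam} {points : Subset n} {blocks : List (Subset n)}
  (isBIBD : IsBIBD (design points blocks) v b′ r′ k lam)
  (B₀ : Fin (length blocks)) where
  open IsBIBD isBIBD
  private
    B = List.lookup blocks B₀
    rest = removeAt blocks B₀

    ─-lookup : ∀ {n} (p q : Subset n) x → lookup (p ─ q) x ≡ lookup p x ∧ not (lookup q x)
    ─-lookup (s ∷ p) (true  ∷ q) zero    = sym (∧-zeroʳ s)
    ─-lookup (s ∷ p) (false ∷ q) zero    = sym (∧-identityʳ s)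
    ─-lookup (s ∷ p) (true  ∷ q) (suc x) = ─-lookup p q x
    ─-lookup (s ∷ p) (false ∷ q) (suc x) = ─-lookup p q x

    B⊆points : B ⊆ points
    B⊆points = All.lookup blocks⊆points (∈-lookup B₀)

  -- Here the symmetric design itself enters, rather than the parameters of R and D. The point x
  -- lies outside the removed block and y inside, so they differ, and none of their common blocks is
  -- the removed one.
  residual-derived-balance : ∀ {x y} → lookup (points ─ B) x ≡ true → lookup B y ≡ true →
    sum (λ c → ⟦ lookup (List.lookup rest c ─ B) x ∧ lookup (List.lookup rest c ∩ B) y ⟧) ≡ lam
  residual-derived-balance {x} {y} x∈ y∈ = begin
    sum (λ c → ⟦ lookup (List.lookup rest c ─ B) x ∧ lookup (List.lookup rest c ∩ B) y ⟧)
      ≡⟨ sum-cong-≗ (λ c → cong ⟦_⟧ (cong₂ _∧_ (in-residual (List.lookup rest c)) (in-derived (List.lookup rest c)))) ⟩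
    sum (λ c → ⟦ both (List.lookup rest c) ⟧)
      ≡⟨ cong (_+ sum (λ c → ⟦ both (List.lookup rest c) ⟧)) (cong (λ s → ⟦ s ∧ lookup B y ⟧) x∉B) ⟨
    ⟦ both B ⟧ + sum (λ c → ⟦ both (List.lookup rest c) ⟧)
      ≡⟨ sum-removeAt (⟦_⟧ ∘ both) blocks B₀ ⟨
    sum (λ c → ⟦ both (List.lookup blocks c) ⟧)
      ≡⟨ sum-cong-≗ (λ c → cong ⟦_⟧ (cong₂ _∧_ (does-∈? x (List.lookup blocks c)) (does-∈? y (List.lookup blocks c)))) ⟨
    sum (λ c → ⟦ does (both? (List.lookup blocks c)) ⟧)
      ≡⟨ length-filter both? blocks ⟨
    length (filter both? blocks)
      ≡⟨ balance (lookup⇒[]= x points x∈points) (B⊆points (lookup⇒[]= y B y∈)) x≢y ⟩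
    lam ∎
    where
    open ≡-Reasoning
    both : Subset n → Bool
    both T = lookup T x ∧ lookup T y
    both? : ∀ T → Dec ((x ∈ T) × (y ∈ T))
    both? T = (x ∈? T) ×-dec (y ∈? T)
    split : ∀ a b → a ∧ not b ≡ true → (a ≡ true) × (b ≡ false)
    split true false e = refl , refl
    x∈points∧x∉B = split (lookup points x) (lookup B x) (trans (sym (─-lookup points B x)) x∈)
    x∈points = proj₁ x∈points∧x∉B
    x∉B = proj₂ x∈points∧x∉B
    x≢y : x ≢ y
    x≢y refl with () ← trans (sym x∉B) y∈
    in-residual : ∀ T → lookup (T ─ B) x ≡ lookup T x
    in-residual T = trans (─-lookup T B x) (trans (cong (λ s → lookup T x ∧ not s) x∉B) (∧-identityʳ _))
    in-derived : ∀ T → lookup (T ∩ B) y ≡ lookup T y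
    in-derived T = trans (lookup-zipWith _∧_ y T B) (trans (cong (lookup T y ∧_) y∈) (∧-identityʳ _))

module _ {n b v k r lam} {B : Subset n} {I : Fin n → Fin b → Bool} (isIncidence : IsIncidence (lookup B) I v r k lam)
  (en : Enumeration B v) where
  open IsIncidence isIncidence
  open Enumeration en

  relabel : IsIncidence (λ _ → true) (I ∘ element) v r k lam
  relabel = record
    { point-count    = trans (sum-const v 1) (ℕₚ.*-identityʳ v)
    ; incident⇒point = λ _ → refl
    ; block-size     = λ c → trans (sum-element (λ x → ⟦ I x c ⟧)) (trans (sum-cong-≗ λ x → absorb x c) (block-size c))
    ; replication    = λ {i} _ → replication (member i)
    ; balance        = λ {i} {j} _ _ i≢j → balance (member i) (member j) (i≢j ∘ injective) }
    where
    absorb : ∀ x c → (if lookup B x then ⟦ I x c ⟧ else 0) ≡ ⟦ I x c ⟧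
    absorb x c with I x c in e
    ... | true  = cong (λ s → if s then 1 else 0) (incident⇒point e)
    ... | false with lookup B x
    ...   | true  = refl
    ...   | false = refl

-- Assembly of the design and its parameters

module _ (h′ : ℕ) where
  private
    h r p : ℕ
    h = suc h′
    r = 2 * h
    p = suc r

  module _
    (F : FiniteDomain p) (S : Design) (isS : IsSBIBD S (2 * p + 1) p h) (B₀ : Design.Block S)
    (isR : IsBIBD (residual S B₀) (suc p) (2 * p) p (suc h) h)
    (isD : IsBIBD (derived S B₀) p (2 * p) r h h′) (m : ℕ) where
    open Geometry F using (P-finite; P-size)
    private
      B = List.lookup (Design.blocks S) B₀
      residualIncidence = BIBD⇒incidence {xs = removeAt (Design.blocks S) B₀} (_─ B) isR
      derivedIncidence = BIBD⇒incidence {xs = removeAt (Design.blocks S) B₀} (_∩ B) isD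
      enumeration : Enumeration B p
      enumeration = subst (Enumeration B) (IsBIBD.point-count isD) (enumerate B)
      open Construction F m (BIBD-block-count (_─ B) isR) residualIncidence (relabel derivedIncidence enumeration)
        (λ Xx s → residual-derived-balance (proj₂ isS) B₀ Xx (Enumeration.member enumeration s))
        using (isIncidence; size-Block)

    extended-design : ∃[ T ] IsSBIBD T (2 * p * ((p ^ suc m ∸ 1) / r) + 1) (p ^ suc m) (p ^ m * h)
    extended-design = incidence⇒design isIncidence , p ^ suc m ,
      subst (λ v → IsBIBD (incidence⇒design isIncidence) v v (p ^ suc m) (p ^ suc m) (p ^ m * h)) count≡
        (subst (λ b → IsBIBD (incidence⇒design isIncidence) (2 * p * size (P-finite (suc m)) + 1) b (p ^ suc m) (p ^ suc m) (p ^ m * h)) size-Block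
          (incidence⇒BIBD isIncidence))
      where
      -- The division is exact: by `P-size`, p^(m+1) - 1 is r times the number of points of the
      -- projective space.
      count≡ : 2 * p * size (P-finite (suc m)) + 1 ≡ 2 * p * ((p ^ suc m ∸ 1) / r) + 1
      count≡ = cong (λ s → 2 * p * s + 1) (sym (trans (/-congˡ {o = r} (cong (_∸ 1) (trans (sym (P-size (suc m))) (cong suc (ℕₚ.*-comm r (size (P-finite (suc m))))))))
        (m*n/n≡m (size (P-finite (suc m))) r)))

IsBIBD-resp : ∀ {D v v₁ b r r₁ k k₁ lam lam₁} → v ≡ v₁ → r ≡ r₁ → k ≡ k₁ → lam ≡ lam₁ →
  IsBIBD D v b r k lam → IsBIBD D v₁ b r₁ k₁ lam₁
IsBIBD-resp refl refl refl refl isBIBD = isBIBD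

-- With p = 2(h + 1) + 1 the value (p - 3) / 2 is h itself, so truncated subtraction does no harm. A
-- zero quotient would mean p = 1, which is no prime power.
odd-primePower : ∀ {p} → PrimePower p → 2 ∣ p ∸ 1 → ∃[ h ] p ≡ suc (2 * suc h)
odd-primePower {p} pp 2∣p-1 = go p (primePower⇒pred-nonZero pp) 2∣p-1
  where
  go : ∀ p → NonZero (p ∸ 1) → 2 ∣ p ∸ 1 → ∃[ h ] p ≡ suc (2 * suc h)
  go (suc _) p-1≢0 (divides zero refl) = ⊥-elim (ℕ.≢-nonZero⁻¹ 0 {{p-1≢0}} refl)
  go (suc _) p-1≢0 (divides (suc h) refl) = h , cong suc (ℕₚ.*-comm (suc h) 2)

theorem6 : (p : ℕ) (pp : PrimePower p) → 2 ∣ p ∸ 1 →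
    (S : Design) → IsSBIBD S (2 * p + 1) p ((p ∸ 1) / 2) →
    (B₀ : Design.Block S) →
    IsBIBD (residual S B₀) (p + 1) (2 * p) p ((p + 1) / 2) ((p ∸ 1) / 2) →
    IsBIBD (derived S B₀) p (2 * p) (p ∸ 1) ((p ∸ 1) / 2) ((p ∸ 3) / 2) →
    (m : ℕ) → .{{_ : NonZero m}} →
    let instance _ = primePower⇒pred-nonZero pp in
    ∃[ T ] IsSBIBD T (2 * p * ((p ^ m ∸ 1) / (p ∸ 1)) + 1) (p ^ m) (p ^ (m ∸ 1) * ((p ∸ 1) / 2))
theorem6 _ pp 2∣p-1 S isS B₀ isR isD m with odd-primePower pp 2∣p-1
theorem6 _ (π , e , π-prime , e≢0 , p≡π^e) 2∣p-1 S isS B₀ isR isD (suc m) | h′ , refl =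
  subst (λ lam → ∃[ T ] IsSBIBD T (2 * p * ((p ^ suc m ∸ 1) / r) + 1) (p ^ suc m) (p ^ m * lam)) (sym half-r)
    (extended-design h′ F S (subst (IsSBIBD S (2 * p + 1) p) half-r isS) B₀
      (IsBIBD-resp (ℕₚ.+-comm p 1) refl half-p+1 half-r isR)
      (IsBIBD-resp refl refl half-r half-p-3 isD) m)
  where
  h = suc h′
  r = 2 * h
  p = suc r
  F : FiniteDomain p
  -- The value of `k` is p - 2, spelled so that `2 + k` reduces to `p`.
  F = finiteDomain-exists {k = h′ + suc (h′ + 0)} π-prime e≢0 p≡π^e
  half : ∀ n → 2 * n / 2 ≡ n
  half n = trans (/-congˡ {o = 2} (ℕₚ.*-comm 2 n)) (m*n/n≡m n 2)
  half-r : r / 2 ≡ h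
  half-r = half h
  half-p+1 : (p + 1) / 2 ≡ suc h
  half-p+1 = trans (/-congˡ {o = 2} (solve 1 (λ h → con 1 :+ con 2 :* h :+ con 1 := con 2 :* (con 1 :+ h)) refl h)) (half (suc h))
    where open +-*-Solver using (solve; con; _:=_; _:+_; _:*_)
  half-p-3 : (p ∸ 3) / 2 ≡ h′
  half-p-3 = trans (/-congˡ {o = 2} (cong (_∸ 1) (ℕₚ.+-suc h′ (h′ + 0)))) (half h′)
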